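{- Let $f(x)$ be a polynomial with nonnegative integer coefficients and of degree at least two. Then for any infinite sequence $\mathcal{S}=\{s_i\}_{i=1}^{\infty}$ of positive integers and for any integer $n\ge 2$, the reciprocal power sum $$H_f(\mathcal{S}_n)=\sum_{k=1}^{n}\frac{1}{f(k)^{s_k}}$$ is not an integer.
   Context: The terms $s_i$ of the sequence $\mathcal{S}$ are not required to be distinct or monotonic. For $n\ge 1$, $\mathcal{S}_n:=\{s_1,\dots,s_n\}$ and $H_f(\mathcal{S}_n):=\sum_{k=1}^{n}\frac{1}{f(k)^{s_k}}$. -}

module Defs where

open import Data.Nat using (ℕ; zero; suc; _+_; _*_; _^_)
open import Data.List using (List; []; _∷_; foldr)
open import Data.Integer using (ℤ; +_)
open import Data.Rational using (ℚ; 0ℚ; _/_) renaming (_+_ to _+ℚ_)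

-- A polynomial with nonnegative integer coefficients, as its coefficient
-- list [a₀, a₁, …, a_d] (lowest degree first).
Poly : Set
Poly = List ℕ

eval : Poly → ℕ → ℕ
eval p x = foldr (λ a acc → a + x * acc) 0 p

-- Degree at least two: the coefficient list, after dropping trailing zeros,
-- has length ≥ 3, i.e. some coefficient of index ≥ 2 is nonzero.
data DegreeAtLeast2 : Poly → Set where
  here  : ∀ {a₀ a₁ m} (rest : List ℕ) → DegreeAtLeast2 (a₀ ∷ a₁ ∷ suc m ∷ rest)
  there : ∀ {a₀ a₁ a₂ rest} → DegreeAtLeast2 (a₁ ∷ a₂ ∷ rest) → DegreeAtLeast2 (a₀ ∷ a₁ ∷ a₂ ∷ rest)

-- 1/m as a rational; the value at 0 is an irrelevant convention (0),
-- never used since f(k)^{s_k} ≥ 1 for k ≥ 1 under the hypotheses.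
recip : ℕ → ℚ
recip zero    = 0ℚ
recip (suc m) = (+ 1) / suc m

H : Poly → (ℕ → ℕ) → ℕ → ℚ
H f s zero    = 0ℚ
H f s (suc n) = H f s n +ℚ recip (eval f (suc n) ^ s (suc n))

{-# OPTIONS --safe #-}

-- Comparison with a telescoping series puts H strictly between two consecutive
-- integers for every f except f = x² + 1, whose full series exceeds 1.
-- For f = x² + 1 it suffices to find a prime dividing k² + 1 for exactly one k ≤ n, since
-- it then survives in the denominator; a prime factor larger than n + k is of this kind.
-- A few explicit primes k² + 1 settle n < 4¹⁷. For larger n the argument is Chebyshev's:
-- suppose all primes dividing P = ∏_{k≤n} (k² + 1) are at most 2n. Place n distinct Gaussian
-- integers z_t in a box with sides about √n and let G = ∏_{t≠u} |z_t − z_u|² ≤ (8n)^(n²).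
-- By pigeonhole (Cauchy–Schwarz) the differences z_t − z_u are divisible by each of the two
-- prime powers above d = pʲ at least as often as random ones, which is, up to a bounded
-- error, as often as d divides the numbers k² + 1. Hence Pⁿ divides G Eⁿ, where
-- E ≤ 4^(13n) by the bound ∏_{p≤m} p ≤ 4^m, and this contradicts P ≥ (n!)² ≥ (n/4)^(2n).
module Submission where

open import Defs
open import Data.Nat using (ℕ; _≤_; _<_)
open import Data.Product using (∃)
open import Data.Integer using (ℤ)
open import Data.Rational using (ℚ)
open import Relation.Binary.PropositionalEquality using (_≡_)
open import Relation.Nullary using (¬_)
open import Data.Rational using (_/_)

open import Data.Bool as Bool using (Bool; true; _∧_; not)
open import Data.Integer as ℤ using (+_; ∣_∣)
open import Data.Integer.DivMod using (_%ℕ_; _/ℕ_; n%ℕd<d; a≡a%ℕn+[a/ℕn]*n)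
open import Data.Integer.Divisibility.Signed as ℤ∣ using (divides; ∣ᵤ⇒∣; ∣⇒∣ᵤ) renaming (_∣_ to _∣ᶻ_)
import Data.Integer.Properties as ℤₚ
import Data.Integer.Tactic.RingSolver as ℤSolver
open import Data.List using ([]; _∷_)
open import Data.List.Relation.Unary.All using (All; []; _∷_)
open import Data.Nat hiding (_/_)
open import Data.Nat.Combinatorics using (_C_; nCk≡nC[n∸k]; nCk+nC[k+1]≡[n+1]C[k+1]; k![n∸k]!∣n!)
open import Data.Nat.Combinatorics.Specification using (nCk≡n!/k![n-k]!)
open import Data.Nat.Divisibility
open import Data.Nat.DivMod using (m%n<n; m≡m%n+[m/n]*n; m<n*o⇒m/o<n; m/n*n≡m) renaming (_/_ to _div_)
open import Data.Nat.Induction using (<-rec)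
open import Data.Nat.ListAction using (product)
open import Data.Nat.Primality
open import Data.Nat.Primality.Factorisation using (factorise)
open import Data.Nat.Properties
open import Data.Nat.Tactic.RingSolver using (solve-∀)
open import Data.Product using (∃₂; _×_; _,_)
open import Data.Rational using (toℚᵘ)
import Data.Rational.Properties as ℚₚ
open import Data.Rational.Unnormalised using (mkℚᵘ; _≃_; *≡*) renaming (_+_ to _+ᵘ_; _/_ to _/ᵘ_)
import Data.Rational.Unnormalised.Properties as ℚᵘₚ
open import Data.Sum using (_⊎_; inj₁; inj₂; [_,_]′)
open import Function using (_∘_)
open import Relation.Binary.Definitions using (tri<; tri≈; tri>)
open import Relation.Binary.PropositionalEquality
open import Relation.Nullary

-- Finite sums and products

∑ : ℕ → (ℕ → ℕ) → ℕ
∑ zero    f = 0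
∑ (suc n) f = ∑ n f + f n

∏ : ℕ → (ℕ → ℕ) → ℕ
∏ zero    f = 1
∏ (suc n) f = ∏ n f * f n

∑-mono : ∀ n {f g} → (∀ {i} → i < n → f i ≤ g i) → ∑ n f ≤ ∑ n g
∑-mono zero    h = z≤n
∑-mono (suc n) h = +-mono-≤ (∑-mono n λ i<n → h (m<n⇒m<1+n i<n)) (h ≤-refl)

∑-cong : ∀ n {f g} → (∀ {i} → i < n → f i ≡ g i) → ∑ n f ≡ ∑ n g
∑-cong zero    h = refl
∑-cong (suc n) h = cong₂ _+_ (∑-cong n λ i<n → h (m<n⇒m<1+n i<n)) (h ≤-refl)

∑-const : ∀ n c → ∑ n (λ _ → c) ≡ n * c
∑-const zero    c = refl
∑-const (suc n) c = trans (cong (_+ c) (∑-const n c)) (+-comm (n * c) c)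

∑-+ : ∀ n f g → ∑ n (λ i → f i + g i) ≡ ∑ n f + ∑ n g
∑-+ zero    f g = refl
∑-+ (suc n) f g rewrite ∑-+ n f g = shuffle (∑ n f) (∑ n g) (f n) (g n)
  where
  shuffle : ∀ a b c d → a + b + (c + d) ≡ a + c + (b + d)
  shuffle = solve-∀

∑-*ˡ : ∀ n c f → ∑ n (λ i → c * f i) ≡ c * ∑ n f
∑-*ˡ zero    c f = sym (*-zeroʳ c)
∑-*ˡ (suc n) c f rewrite ∑-*ˡ n c f = sym (*-distribˡ-+ c (∑ n f) (f n))

∑-*ʳ : ∀ n c f → ∑ n (λ i → f i * c) ≡ ∑ n f * c
∑-*ʳ n c f = trans (∑-cong n λ {i} _ → *-comm (f i) c) (trans (∑-*ˡ n c f) (*-comm c _))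

∑-swap : ∀ m n (f : ℕ → ℕ → ℕ) → ∑ m (λ i → ∑ n (f i)) ≡ ∑ n (λ j → ∑ m (λ i → f i j))
∑-swap zero    n f = sym (trans (∑-const n 0) (*-zeroʳ n))
∑-swap (suc m) n f rewrite ∑-swap m n f = sym (∑-+ n (λ j → ∑ m (λ i → f i j)) (f m))

∏-mono : ∀ n {f g} → (∀ {i} → i < n → f i ≤ g i) → ∏ n f ≤ ∏ n g
∏-mono zero    h = ≤-refl
∏-mono (suc n) h = *-mono-≤ (∏-mono n λ i<n → h (m<n⇒m<1+n i<n)) (h ≤-refl)

∏-const : ∀ n c → ∏ n (λ _ → c) ≡ c ^ n
∏-const zero    c = refl
∏-const (suc n) c = trans (cong (_* c) (∏-const n c)) (*-comm (c ^ n) c)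

∏>0 : ∀ n {f} → (∀ {i} → i < n → 0 < f i) → 0 < ∏ n f
∏>0 n h = ≤-trans (≤-reflexive (sym (trans (∏-const n 1) (^-zeroˡ n)))) (∏-mono n h)

∏-∈ : ∀ n f {i} → i < n → f i ∣ ∏ n f
∏-∈ (suc n) f {i} (s≤s i≤n) with i ≟ n
... | yes refl = n∣m*n (∏ n f)
... | no i≢n   = ∣m⇒∣m*n (f n) (∏-∈ n f (≤∧≢⇒< i≤n i≢n))

∏-^∣ : ∀ n p {e f} → (∀ {i} → i < n → p ^ e i ∣ f i) → p ^ ∑ n e ∣ ∏ n f
∏-^∣ zero    p h = ∣-refl
∏-^∣ (suc n) p {e} {f} h = ∣-trans (∣-reflexive (^-distribˡ-+-* p (∑ n e) (e n)))
  (*-pres-∣ (∏-^∣ n p λ i<n → h (m<n⇒m<1+n i<n)) (h ≤-refl))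

-- Indicators and double counting

⟦_⟧ : ∀ {a} {A : Set a} → Dec A → ℕ
⟦ yes _ ⟧ = 1
⟦ no  _ ⟧ = 0

⟦⟧-mono : ∀ {a b} {A : Set a} {B : Set b} (A? : Dec A) (B? : Dec B) → (A → B) → ⟦ A? ⟧ ≤ ⟦ B? ⟧
⟦⟧-mono (no  _) B?      f = z≤n
⟦⟧-mono (yes a) (yes _) f = ≤-refl
⟦⟧-mono (yes a) (no ¬b) f = contradiction (f a) ¬b

⟦⟧≤1 : ∀ {a} {A : Set a} (A? : Dec A) → ⟦ A? ⟧ ≤ 1
⟦⟧≤1 (yes _) = ≤-refl
⟦⟧≤1 (no  _) = z≤n

⟦⟧-yes : ∀ {a} {A : Set a} (A? : Dec A) → A → ⟦ A? ⟧ ≡ 1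
⟦⟧-yes (yes _) a = refl
⟦⟧-yes (no ¬a) a = contradiction a ¬a

⟦⟧-no : ∀ {a} {A : Set a} (A? : Dec A) → ¬ A → ⟦ A? ⟧ ≡ 0
⟦⟧-no (yes a) ¬a = contradiction a ¬a
⟦⟧-no (no  _) ¬a = refl

⟦⟧-⊎ : ∀ {a b c} {A : Set a} {B : Set b} {C : Set c} (A? : Dec A) (B? : Dec B) (C? : Dec C) →
       (A → B ⊎ C) → ⟦ A? ⟧ ≤ ⟦ B? ⟧ + ⟦ C? ⟧
⟦⟧-⊎ (no _)  B? C? f = z≤n
⟦⟧-⊎ (yes a) B? C? f with f a
... | inj₁ b rewrite ⟦⟧-yes B? b = s≤s z≤n
... | inj₂ c rewrite ⟦⟧-yes C? c = m≤n+m 1 ⟦ B? ⟧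

-- Only the most recent element of the set matters for the induction.
separated-count : ∀ {ℓ} {Q : ℕ → Set ℓ} (Q? : ∀ k → Dec (Q k)) d →
  ∀ n → (∀ {k l} → k < l → l < n → Q k → Q l → k + d ≤ l) →
  d * ∑ n (λ k → ⟦ Q? k ⟧) ≤ n + d
separated-count {Q = Q} Q? d n sep with go n ≤-refl
  where
  count : ℕ → ℕ
  count m = ∑ m (λ k → ⟦ Q? k ⟧)
  go : ∀ m → m ≤ n → count m ≡ 0 ⊎ ∃ λ l → l < m × Q l × d * count m ≤ l + d
  go zero    _ = inj₁ refl
  go (suc m) m<n with Q? m | go m (<⇒≤ m<n)
  ... | no _  | inj₁ c≡0 = inj₁ (trans (+-identityʳ _) c≡0)
  ... | no _  | inj₂ (l , l<m , q , b) =
    inj₂ (l , m<n⇒m<1+n l<m , q , ≤-trans (≤-reflexive (cong (d *_) (+-identityʳ _))) b)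
  ... | yes q | inj₁ c≡0 = inj₂ (m , ≤-refl , q , (begin
      d * (count m + 1) ≡⟨ cong (λ c → d * (c + 1)) c≡0 ⟩
      d * 1             ≡⟨ *-identityʳ d ⟩
      d                 ≤⟨ m≤n+m d m ⟩
      m + d             ∎))
    where open ≤-Reasoning
  ... | yes q | inj₂ (l , l<m , q′ , b) = inj₂ (m , ≤-refl , q , (begin
      d * (count m + 1)   ≡⟨ *-distribˡ-+ d (count m) 1 ⟩
      d * count m + d * 1 ≡⟨ cong (λ z → d * count m + z) (*-identityʳ d) ⟩
      d * count m + d     ≤⟨ +-monoˡ-≤ d b ⟩
      l + d + d           ≤⟨ +-monoˡ-≤ d (sep l<m m<n q′ q) ⟩
      m + d               ∎))
    where open ≤-Reasoning
... | inj₁ c≡0 rewrite c≡0 | *-zeroʳ d = z≤n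
... | inj₂ (l , l<n , _ , b) = ≤-trans b (+-monoˡ-≤ d (<⇒≤ l<n))

2xy≤x²+y² : ∀ x y → 2 * (x * y) ≤ x * x + y * y
2xy≤x²+y² x y with ≤-total x y
... | inj₁ x≤y with m≤n⇒∃[o]m+o≡n x≤y
... | k , refl = ≤-trans (m≤m+n _ (k * k)) (≤-reflexive (eq x k))
  where
  eq : ∀ x k → 2 * (x * (x + k)) + k * k ≡ x * x + (x + k) * (x + k)
  eq = solve-∀
2xy≤x²+y² x y | inj₂ y≤x with m≤n⇒∃[o]m+o≡n y≤x
... | k , refl = ≤-trans (m≤m+n _ (k * k)) (≤-reflexive (eq y k))
  where
  eq : ∀ x k → 2 * ((x + k) * x) + k * k ≡ (x + k) * (x + k) + x * x
  eq = solve-∀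

-- Cauchy-Schwarz against the constant vector: the square is expanded into a double sum and doubled,
-- so that `2xy≤x²+y²` applies to each product.
∑²≤ : ∀ d N → ∑ d N * ∑ d N ≤ d * ∑ d (λ c → N c * N c)
∑²≤ d N = *-cancelˡ-≤ 2 (begin
  2 * (∑ d N * ∑ d N)
    ≡⟨ cong (2 *_) (sym (∑-*ʳ d (∑ d N) N)) ⟩
  2 * ∑ d (λ a → N a * ∑ d N)
    ≡⟨ sym (∑-*ˡ d 2 _) ⟩
  ∑ d (λ a → 2 * (N a * ∑ d N))
    ≡⟨ ∑-cong d (λ {a} _ → trans (cong (2 *_) (sym (∑-*ˡ d (N a) N))) (sym (∑-*ˡ d 2 _))) ⟩
  ∑ d (λ a → ∑ d (λ b → 2 * (N a * N b)))
    ≤⟨ ∑-mono d (λ {a} _ → ∑-mono d λ {b} _ → 2xy≤x²+y² (N a) (N b)) ⟩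
  ∑ d (λ a → ∑ d (λ b → N a * N a + N b * N b))
    ≡⟨ ∑-cong d (λ {a} _ → trans (∑-+ d _ _) (cong (_+ Q) (∑-const d (N a * N a)))) ⟩
  ∑ d (λ a → d * (N a * N a) + Q)
    ≡⟨ trans (∑-+ d _ _) (cong₂ _+_ (∑-*ˡ d d _) (∑-const d Q)) ⟩
  d * Q + d * Q
    ≡⟨ cong (λ z → d * Q + z) (sym (+-identityʳ (d * Q))) ⟩
  2 * (d * Q) ∎)
  where
  open ≤-Reasoning
  Q : ℕ
  Q = ∑ d (λ c → N c * N c)

∑-select : ∀ d (g : ℕ → ℕ) {r} → r < d → ∑ d (λ c → ⟦ r ≟ c ⟧ * g c) ≡ g r
∑-select (suc d) g {r} (s≤s r≤d) with r ≟ d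
... | yes refl = cong₂ _+_ (zeros d ≤-refl) (+-identityʳ (g r))
  where
  zeros : ∀ m → m ≤ r → ∑ m (λ c → ⟦ r ≟ c ⟧ * g c) ≡ 0
  zeros m m≤r = trans (∑-cong m λ {c} c<m → cong (_* g c) (⟦⟧-no (r ≟ c) (>⇒≢ (<-≤-trans c<m m≤r))))
                      (trans (∑-const m 0) (*-zeroʳ m))
... | no r≢d = trans (+-identityʳ _) (∑-select d g (≤∧≢⇒< r≤d r≢d))

-- The fibres of `c` have total size `n`, and the squares of their sizes count the colliding ordered
-- pairs, diagonal included; `∑²≤` compares the two.
collisions : ∀ n d (c : ℕ → ℕ) → (∀ {t} → t < n → c t < d) →
  n * n ≤ d * ∑ n (λ t → ∑ n (λ u → ⟦ c t ≟ c u ⟧))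
collisions n d c c<d = begin
  n * n                                          ≡⟨ cong₂ _*_ n≡ n≡ ⟩
  ∑ d fibre * ∑ d fibre                          ≤⟨ ∑²≤ d fibre ⟩
  d * ∑ d (λ a → fibre a * fibre a)              ≡⟨ cong (d *_) square ⟩
  d * ∑ n (λ t → ∑ n (λ u → ⟦ c t ≟ c u ⟧))      ∎
  where
  open ≤-Reasoning
  fibre : ℕ → ℕ
  fibre a = ∑ n (λ t → ⟦ c t ≟ a ⟧)
  n≡ : n ≡ ∑ d fibre
  n≡ = sym (trans (∑-swap d n _)
    (trans (∑-cong n λ {t} t<n → trans (∑-cong d λ {a} _ → sym (*-identityʳ ⟦ c t ≟ a ⟧)) (∑-select d (λ _ → 1) (c<d t<n)))
    (trans (∑-const n 1) (*-identityʳ n))))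
  flip-≟ : ∀ a b → ⟦ a ≟ b ⟧ ≡ ⟦ b ≟ a ⟧
  flip-≟ a b = ≤-antisym (⟦⟧-mono (a ≟ b) (b ≟ a) sym) (⟦⟧-mono (b ≟ a) (a ≟ b) sym)
  square : ∑ d (λ a → fibre a * fibre a) ≡ ∑ n (λ t → ∑ n (λ u → ⟦ c t ≟ c u ⟧))
  square = trans (∑-cong d λ {a} _ → sym (∑-*ʳ n (fibre a) _))
    (trans (∑-swap d n _)
    (∑-cong n λ {t} t<n → trans (∑-select d fibre (c<d t<n)) (∑-cong n λ {u} _ → flip-≟ (c u) (c t))))

-- Prime powers and valuations

^-monoʳ-∣ : ∀ p {m n} → m ≤ n → p ^ m ∣ p ^ n
^-monoʳ-∣ p {m} m≤n with m≤n⇒∃[o]m+o≡n m≤n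
... | o , refl = ∣-trans (m∣m*n (p ^ o)) (∣-reflexive (sym (^-distribˡ-+-* p m o)))

prime∣^⇒∣ : ∀ {p} → Prime p → ∀ m e → p ∣ m ^ e → p ∣ m
prime∣^⇒∣ pp m zero    p∣1 = contradiction (subst Prime (∣1⇒≡1 p∣1) pp) ¬prime[1]
prime∣^⇒∣ pp m (suc e) h with euclidsLemma m (m ^ e) pp h
... | inj₁ p∣m = p∣m
... | inj₂ p∣m^e = prime∣^⇒∣ pp m e p∣m^e

prime∣∏ : ∀ {p} → Prime p → ∀ n f → p ∣ ∏ n f → ∃ λ i → i < n × p ∣ f i
prime∣∏ pp zero    f p∣1 = contradiction (subst Prime (∣1⇒≡1 p∣1) pp) ¬prime[1]
prime∣∏ pp (suc n) f h with euclidsLemma (∏ n f) (f n) pp h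
... | inj₂ p∣fn = n , ≤-refl , p∣fn
... | inj₁ p∣∏ with prime∣∏ pp n f p∣∏
... | i , i<n , p∣fi = i , m<n⇒m<1+n i<n , p∣fi

-- Euclid's lemma is applied `e` times; each time one factor `p` is cancelled from `a` or from `b`.
prime^∣*-split : ∀ {p} → Prime p → ∀ e {a b} → p ^ e ∣ a * b →
  ∃₂ λ i l → i + l ≡ e × (p ^ i ∣ a) × (p ^ l ∣ b)
prime^∣*-split pp zero h = 0 , 0 , refl , 1∣ _ , 1∣ _
prime^∣*-split {p} pp (suc e) {a} {b} h with euclidsLemma a b pp (m*n∣⇒m∣ p (p ^ e) h)
... | inj₁ (divides a′ refl) =
  let i , l , eq , x , y = prime^∣*-split pp e {a′} {b}
        (*-cancelˡ-∣ p (subst (p ^ suc e ∣_) (shuffle a′ p b) h))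
  in suc i , l , cong suc eq , subst (p ^ suc i ∣_) (*-comm p a′) (*-monoʳ-∣ p x) , y
  where
  instance _ = prime⇒nonZero pp
  shuffle : ∀ x y z → x * y * z ≡ y * (x * z)
  shuffle = solve-∀
... | inj₂ (divides b′ refl) =
  let i , l , eq , x , y = prime^∣*-split pp e {a} {b′}
        (*-cancelˡ-∣ p (subst (p ^ suc e ∣_) (shuffle a b′ p) h))
  in i , suc l , trans (+-suc i l) (cong suc eq) , x , subst (p ^ suc l ∣_) (*-comm p b′) (*-monoʳ-∣ p y)
  where
  instance _ = prime⇒nonZero pp
  shuffle : ∀ x y z → x * (y * z) ≡ z * (x * y)
  shuffle = solve-∀

prime^∣*-cancel : ∀ {p} → Prime p → ∀ e {a b} → p ∤ a → p ^ e ∣ a * b → p ^ e ∣ b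
prime^∣*-cancel {p} pp e {a} {b} p∤a h with prime^∣*-split pp e {a} {b} h
... | zero  , l , refl , _ , y = y
... | suc i , l , refl , x , _ = contradiction (m*n∣⇒m∣ p (p ^ i) x) p∤a

-- Bounding the exponents of all dividing powers avoids choosing a valuation; by `prime^∣*-split`
-- such bounds add under multiplication.
Val≤ : ℕ → ℕ → ℕ → Set
Val≤ p a v = ∀ e → p ^ e ∣ a → e ≤ v

Val≤-* : ∀ {p} → Prime p → ∀ {a b u v} → Val≤ p a u → Val≤ p b v → Val≤ p (a * b) (u + v)
Val≤-* pp {a} {b} ha hb e h with prime^∣*-split pp e {a} {b} h
... | i , l , refl , x , y = +-mono-≤ (ha i x) (hb l y)

Val≤-1 : ∀ {p} → Prime p → Val≤ p 1 0
Val≤-1 pp zero    h = z≤n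
Val≤-1 {p} pp (suc e) h = contradiction (subst Prime (∣1⇒≡1 (m*n∣⇒m∣ p (p ^ e) h)) pp) ¬prime[1]

Val≤-∏ : ∀ {p} → Prime p → ∀ n {f v} → (∀ {i} → i < n → Val≤ p (f i) (v i)) → Val≤ p (∏ n f) (∑ n v)
Val≤-∏ pp zero    h = Val≤-1 pp
Val≤-∏ pp (suc n) h = Val≤-* pp (Val≤-∏ pp n λ i<n → h (m<n⇒m<1+n i<n)) (h ≤-refl)

Val≤-^ : ∀ {p} → Prime p → ∀ n {a v} → Val≤ p a v → Val≤ p (a ^ n) (n * v)
Val≤-^ pp zero    h = Val≤-1 pp
Val≤-^ pp (suc n) h = Val≤-* pp h (Val≤-^ pp n h)

-- The p-adic valuation, truncated at L.
val : ℕ → ℕ → ℕ → ℕ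
val p L a = ∑ L (λ j → ⟦ p ^ suc j ∣? a ⟧)

val≤ : ∀ p L a → val p L a ≤ L
val≤ p L a = ≤-trans (∑-mono L λ {j} _ → ⟦⟧≤1 (p ^ suc j ∣? a))
                     (≤-reflexive (trans (∑-const L 1) (*-identityʳ L)))

^val∣ : ∀ p L a → p ^ val p L a ∣ a
^val∣ p zero    a = 1∣ a
^val∣ p (suc L) a with p ^ suc L ∣? a
... | no  _ = subst (λ v → p ^ v ∣ a) (sym (+-identityʳ (val p L a))) (^val∣ p L a)
... | yes h = ∣-trans (^-monoʳ-∣ p (≤-trans (≤-reflexive (+-comm _ 1)) (s≤s (val≤ p L a)))) h

≤val : ∀ p L {a e} → e ≤ L → p ^ e ∣ a → e ≤ val p L a
≤val p zero    z≤n h = z≤n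
≤val p (suc L) {a} {e} e≤ h with m≤n⇒m<n∨m≡n e≤
... | inj₁ (s≤s e≤L) = m≤n⇒m≤n+o _ (≤val p L e≤L h)
... | inj₂ refl rewrite ⟦⟧-yes (p ^ suc L ∣? a) h =
  ≤-trans (s≤s (≤val p L ≤-refl (∣-trans (^-monoʳ-∣ p (n≤1+n L)) h))) (≤-reflexive (+-comm 1 _))

Val≤-val : ∀ p L {a} → p ^ suc L ∤ a → Val≤ p a (val p L a)
Val≤-val p L h e p^e∣a = ≤val p L (≮⇒≥ λ L<e → h (∣-trans (^-monoʳ-∣ p L<e) p^e∣a)) p^e∣a

-- Induction on the prime factors of `m`, cancelling one prime `p` from both numbers. For powers of
-- `p` this lowers the exponent by one; powers of any other prime are coprime to `p`.
∣-by-primePowers : ∀ m {n} .{{_ : NonZero m}} →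
  (∀ {p} → Prime p → ∀ e → p ^ e ∣ m → p ^ e ∣ n) → m ∣ n
∣-by-primePowers m {n} h with factorise m
... | record { factors = ps ; isFactorisation = refl ; factorsPrime = prs } = go ps prs h
  where
  go : ∀ ps → All Prime ps → ∀ {n} →
       (∀ {p} → Prime p → ∀ e → p ^ e ∣ product ps → p ^ e ∣ n) → product ps ∣ n
  go []       []         h = 1∣ _
  go (p ∷ ps) (pp ∷ prs) h
    with h pp 1 (subst (_∣ p * product ps) (sym (^-identityʳ p)) (m∣m*n (product ps)))
  ... | p∣n rewrite ^-identityʳ p with p∣n
  ... | divides n′ refl =
    subst (p * product ps ∣_) (*-comm p n′) (*-monoʳ-∣ p (go ps prs λ {q} pq e q^e∣ → step pq e q^e∣))
    where
    instance _ = prime⇒nonZero pp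
    step : ∀ {q} → Prime q → ∀ e → q ^ e ∣ product ps → q ^ e ∣ n′
    step {q} pq e q^e∣ with q ≟ p
    ... | yes refl = *-cancelˡ-∣ p (subst (p ^ suc e ∣_) (*-comm n′ p) (h pp (suc e) (*-monoʳ-∣ p q^e∣)))
    ... | no q≢p   = prime^∣*-cancel pq e q∤p
                       (subst (q ^ e ∣_) (*-comm n′ p) (h pq e (∣n⇒∣m*n p q^e∣)))
      where
      q∤p : q ∤ p
      q∤p q∣p with prime⇒irreducible pp q∣p
      ... | inj₁ refl = ¬prime[1] pq
      ... | inj₂ q≡p  = q≢p q≡p

-- Binomial coefficients and primorials

choose-! : ∀ {n k} → k ≤ n → (n C k) * (k ! * (n ∸ k) !) ≡ n !
choose-! {n} {k} k≤n = trans (cong (_* (k ! * (n ∸ k) !)) (nCk≡n!/k![n-k]! k≤n))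
                             (m/n*n≡m {{k !* (n ∸ k) !≢0}} (k![n∸k]!∣n! k≤n))

∣! : ∀ {d n} → .{{NonZero d}} → d ≤ n → d ∣ n !
∣! {suc d} d≤n = ∣-trans (m∣m*n (d !)) (m≤n⇒m!∣n! d≤n)

prime∣!⇒≤ : ∀ {p} → Prime p → ∀ n → p ∣ n ! → p ≤ n
prime∣!⇒≤ pp zero    h = contradiction (subst Prime (∣1⇒≡1 h) pp) ¬prime[1]
prime∣!⇒≤ pp (suc n) h with euclidsLemma (suc n) (n !) pp h
... | inj₁ p∣sn = ∣⇒≤ p∣sn
... | inj₂ p∣n! = m≤n⇒m≤1+n (prime∣!⇒≤ pp n p∣n!)

-- `p` divides `n !` but is too large to divide either factorial in the denominator.
prime∣choose : ∀ {p n k} → Prime p → k ≤ n → p ≤ n → k < p → n ∸ k < p → p ∣ n C k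
prime∣choose {p} {n} {k} pp k≤n p≤n k<p n-k<p
  with euclidsLemma (n C k) (k ! * (n ∸ k) !) pp
         (subst (p ∣_) (sym (choose-! k≤n)) (∣! {{prime⇒nonZero pp}} p≤n))
... | inj₁ h = h
... | inj₂ h with euclidsLemma (k !) ((n ∸ k) !) pp h
... | inj₁ h′ = contradiction (prime∣!⇒≤ pp k h′) (<⇒≱ k<p)
... | inj₂ h′ = contradiction (prime∣!⇒≤ pp (n ∸ k) h′) (<⇒≱ n-k<p)

-- By Pascal's rule the bound at most doubles from row to row. Bounding two neighbours together
-- serves `choose-mid-odd`, where the two middle entries coincide.
choose+choose≤2^ : ∀ n k → n C k + n C suc k ≤ 2 ^ n
choose+choose≤2^ zero    zero    = ≤-refl
choose+choose≤2^ zero    (suc k) = z≤n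
choose+choose≤2^ (suc n) zero    = begin
  suc n C 0 + suc n C 1     ≡⟨ cong (λ z → suc n C 0 + z) (sym (nCk+nC[k+1]≡[n+1]C[k+1] n 0)) ⟩
  1 + (n C 0 + n C 1)       ≤⟨ +-mono-≤ (m^n>0 2 n) (choose+choose≤2^ n 0) ⟩
  2 ^ n + 2 ^ n             ≡⟨ cong (λ z → 2 ^ n + z) (sym (+-identityʳ _)) ⟩
  2 ^ suc n                 ∎
  where open ≤-Reasoning
choose+choose≤2^ (suc n) (suc k) = begin
  suc n C suc k + suc n C suc (suc k)
    ≡⟨ cong₂ _+_ (sym (nCk+nC[k+1]≡[n+1]C[k+1] n k)) (sym (nCk+nC[k+1]≡[n+1]C[k+1] n (suc k))) ⟩
  (n C k + n C suc k) + (n C suc k + n C suc (suc k))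
    ≤⟨ +-mono-≤ (choose+choose≤2^ n k) (choose+choose≤2^ n (suc k)) ⟩
  2 ^ n + 2 ^ n
    ≡⟨ cong (λ z → 2 ^ n + z) (sym (+-identityʳ _)) ⟩
  2 ^ suc n ∎
  where open ≤-Reasoning

choose≤2^ : ∀ n k → n C k ≤ 2 ^ n
choose≤2^ n k = ≤-trans (m≤m+n _ _) (choose+choose≤2^ n k)

2^[n+n]≡4^n : ∀ n → 2 ^ (n + n) ≡ 4 ^ n
2^[n+n]≡4^n n = trans (cong (2 ^_) (cong (λ z → n + z) (sym (+-identityʳ n)))) (sym (^-*-assoc 2 2 n))

choose-mid-odd : ∀ k → suc (k + k) C k ≤ 4 ^ k
choose-mid-odd k = *-cancelˡ-≤ 2 (begin
  2 * (n C k)            ≡⟨ cong (λ z → n C k + z) (+-identityʳ _) ⟩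
  n C k + n C k          ≡⟨ cong (λ z → n C k + z) (trans (nCk≡nC[n∸k] k≤n) (cong (n C_) n∸k)) ⟩
  n C k + n C suc k      ≤⟨ choose+choose≤2^ n k ⟩
  2 * 2 ^ (k + k)        ≡⟨ cong (2 *_) (2^[n+n]≡4^n k) ⟩
  2 * 4 ^ k              ∎)
  where
  open ≤-Reasoning
  n = suc (k + k)
  k≤n : k ≤ n
  k≤n = m≤n⇒m≤1+n (m≤m+n k k)
  n∸k : n ∸ k ≡ suc k
  n∸k = m+n∸n≡m (suc k) k

choose>0 : ∀ {n k} → k ≤ n → 0 < n C k
choose>0 {n} {k} k≤n = n≢0⇒n>0 λ c≡0 → ≢-nonZero⁻¹ (n !) {{n !≢0}}
  (trans (sym (choose-! k≤n)) (cong (_* (k ! * (n ∸ k) !)) c≡0))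

-- A weak Stirling bound, with 4 in place of e. Factor by factor, n^n n! is at most (2n)!, which is
-- the central binomial coefficient, at most 4^n, times (n!)².
n^n≤4^n*n! : ∀ n → n ^ n ≤ 4 ^ n * n !
n^n≤4^n*n! n = *-cancelʳ-≤ (n ^ n) _ (n !) {{n !≢0}} (begin
  n ^ n * n !                        ≤⟨ rising n ⟩
  (n + n) !                          ≡⟨ sym (choose-! (m≤m+n n n)) ⟩
  ((n + n) C n) * (n ! * (n + n ∸ n) !) ≡⟨ cong (λ z → ((n + n) C n) * (n ! * z !)) (m+n∸n≡m n n) ⟩
  ((n + n) C n) * (n ! * n !)          ≤⟨ *-monoˡ-≤ (n ! * n !) (choose≤2^ (n + n) n) ⟩
  2 ^ (n + n) * (n ! * n !)          ≡⟨ cong (_* (n ! * n !)) (2^[n+n]≡4^n n) ⟩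
  4 ^ n * (n ! * n !)                ≡⟨ sym (*-assoc (4 ^ n) (n !) (n !)) ⟩
  4 ^ n * n ! * n !                  ∎)
  where
  open ≤-Reasoning
  rising : ∀ m → n ^ m * n ! ≤ (m + n) !
  rising zero    = ≤-reflexive (+-identityʳ (n !))
  rising (suc m) = ≤-trans (≤-reflexive (*-assoc n (n ^ m) (n !)))
    (*-mono-≤ (≤-trans (m≤n+m n m) (n≤1+n (m + n))) (rising m))

-- The neutral value 1 off the primes lets the primorial `_#` run over all integers up to `n`.
primeOr1 : ℕ → ℕ
primeOr1 m with prime? m
... | yes _ = m
... | no  _ = 1

primeOr1-prime : ∀ {p} → Prime p → primeOr1 p ≡ p
primeOr1-prime {p} pp with prime? p
... | yes _  = refl
... | no ¬pp = contradiction pp ¬pp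

primeOr1>0 : ∀ m → 0 < primeOr1 m
primeOr1>0 m with prime? m
... | yes pm = >-nonZero⁻¹ m {{prime⇒nonZero pm}}
... | no  _  = ≤-refl

prime∣primeOr1 : ∀ {p} → Prime p → ∀ m → p ∣ primeOr1 m → p ≤ m
prime∣primeOr1 pp m h with prime? m
... | yes pm = ∣⇒≤ {{prime⇒nonZero pm}} h
... | no  _  = contradiction (subst Prime (∣1⇒≡1 h) pp) ¬prime[1]

infix 9 _#
_# : ℕ → ℕ
n # = ∏ n (λ i → primeOr1 (suc i))

#>0 : ∀ n → 0 < n #
#>0 n = ∏>0 n λ {i} _ → primeOr1>0 (suc i)

prime∣# : ∀ {p n} → Prime p → p ≤ n → p ∣ n #
prime∣# {zero}  pp p≤n = contradiction pp ¬prime[0]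
prime∣# {suc p} {n} pp p<n = subst (_∣ n #) (primeOr1-prime pp) (∏-∈ n (λ i → primeOr1 (suc i)) p<n)

-- A new prime `q` exceeds, hence does not divide, every factor of the product `X` so far; dividing
-- `c = y * X`, it must divide the cofactor `y`.
∏-primes∣ : ∀ m i {c} → (∀ {p} → Prime p → m < p → p ≤ m + i → p ∣ c) →
  ∏ i (λ j → primeOr1 (suc (m + j))) ∣ c
∏-primes∣ m zero    h = 1∣ _
∏-primes∣ m (suc i) {c} h
  with ∏-primes∣ m i {c} (λ pp m<p p≤m+i → h pp m<p (≤-trans p≤m+i (+-monoʳ-≤ m (n≤1+n i))))
... | X∣c with prime? (suc (m + i))
... | no  _  = subst (_∣ c) (sym (*-identityʳ _)) X∣c
... | yes pp with X∣c
... | divides y refl = subst (_∣ y * X) (*-comm q X) (*-monoˡ-∣ X q∣y)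
  where
  X = ∏ i (λ j → primeOr1 (suc (m + j)))
  q = suc (m + i)
  q∣y : q ∣ y
  q∣y with euclidsLemma y X pp (h pp (s≤s (m≤m+n m i)) (≤-reflexive (sym (+-suc m i))))
  ... | inj₁ q∣y = q∣y
  ... | inj₂ q∣X with prime∣∏ pp i _ q∣X
  ... | j , j<i , q∣ = contradiction (prime∣primeOr1 pp _ q∣) (<⇒≱ (s≤s (+-monoʳ-< m j<i)))

#-split : ∀ m i → (m + i) # ≡ m # * ∏ i (λ j → primeOr1 (suc (m + j)))
#-split m zero rewrite +-identityʳ m = sym (*-identityʳ (m #))
#-split m (suc i) rewrite +-suc m i | #-split m i = *-assoc (m #) _ _

#-step : ∀ m i {c} → 0 < c → (∀ {p} → Prime p → m < p → p ≤ m + i → p ∣ c) → (m + i) # ≤ m # * c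
#-step m i c>0 h = ≤-trans (≤-reflexive (#-split m i))
  (*-monoʳ-≤ (m #) (∣⇒≤ {{>-nonZero c>0}} (∏-primes∣ m i h)))

even⊎odd : ∀ n → ∃ λ k → n ≡ k + k ⊎ n ≡ suc (k + k)
even⊎odd zero = 0 , inj₁ refl
even⊎odd (suc n) with even⊎odd n
... | k , inj₁ refl = k , inj₂ refl
... | k , inj₂ refl = suc k , inj₁ (cong suc (sym (+-suc k k)))

-- Erdős's argument: the primes in the upper half of the range divide a middle binomial coefficient
-- of size at most 4^k, and the lower half is handled by strong induction.
#≤4^ : ∀ n → n # ≤ 4 ^ n
#≤4^ = <-rec _ step
  where
  step : ∀ n → (∀ {m} → m < n → m # ≤ 4 ^ m) → n # ≤ 4 ^ n
  step n rec with even⊎odd n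
  ... | zero  , inj₁ refl = ≤-refl
  ... | zero  , inj₂ refl = s≤s z≤n
  ... | suc k′ , inj₁ refl = begin
    (k + k) #                ≤⟨ #-step k k (choose>0 (m≤m+n k k)) (λ {p} pp k<p p≤ →
        prime∣choose pp (m≤m+n k k) p≤ k<p (subst (_< p) (sym (m+n∸n≡m k k)) k<p)) ⟩
    k # * ((k + k) C k)      ≤⟨ *-mono-≤ (rec (m<m+n k z<s)) (choose≤2^ (k + k) k) ⟩
    4 ^ k * 2 ^ (k + k)      ≡⟨ cong (4 ^ k *_) (2^[n+n]≡4^n k) ⟩
    4 ^ k * 4 ^ k            ≡⟨ sym (^-distribˡ-+-* 4 k k) ⟩
    4 ^ (k + k)              ∎
    where
    open ≤-Reasoning
    k = suc k′
  ... | suc k′ , inj₂ refl = begin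
    suc (k + k) #              ≤⟨ #-step (suc k) k (choose>0 k≤) (λ {p} pp k<p p≤ →
        prime∣choose pp k≤ p≤ (<-trans (n<1+n k) k<p) (subst (_< p) (sym (m+n∸n≡m (suc k) k)) k<p)) ⟩
    suc k # * (suc (k + k) C k) ≤⟨ *-mono-≤ (rec (s≤s (m<m+n k z<s))) (choose-mid-odd k) ⟩
    4 ^ suc k * 4 ^ k          ≡⟨ sym (^-distribˡ-+-* 4 (suc k) k) ⟩
    4 ^ suc (k + k)            ∎
    where
    open ≤-Reasoning
    k = suc k′
    k≤ : k ≤ suc (k + k)
    k≤ = m≤n⇒m≤1+n (m≤m+n k k)

-- Square roots of −1 modulo prime powers

∣ᶻ-cast : ∀ {k i j} → i ≡ j → k ∣ᶻ i → k ∣ᶻ j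
∣ᶻ-cast refl h = h

prime^∣ᶻ*-split : ∀ {p} → Prime p → ∀ e x y → + (p ^ e) ∣ᶻ x ℤ.* y →
  ∃₂ λ i l → i + l ≡ e × + (p ^ i) ∣ᶻ x × + (p ^ l) ∣ᶻ y
prime^∣ᶻ*-split {p} pp e x y h
  with prime^∣*-split pp e {∣ x ∣} {∣ y ∣} (subst (p ^ e ∣_) (ℤₚ.abs-* x y) (∣⇒∣ᵤ h))
... | i , l , eq , hx , hy = i , l , eq , ∣ᵤ⇒∣ hx , ∣ᵤ⇒∣ hy

prime^∣ᶻ*-cancel : ∀ {p} → Prime p → ∀ e x {y} → p ∤ ∣ x ∣ → + (p ^ e) ∣ᶻ x ℤ.* y → + (p ^ e) ∣ᶻ y
prime^∣ᶻ*-cancel {p} pp e x {y} p∤x h =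
  ∣ᵤ⇒∣ (prime^∣*-cancel pp e p∤x (subst (p ^ e ∣_) (ℤₚ.abs-* x y) (∣⇒∣ᵤ h)))

root-unit : ∀ {p} → Prime p → ∀ r → + p ∣ᶻ r ℤ.* r ℤ.+ + 1 → p ∤ ∣ r ∣
root-unit {p} pp r h p∣r = contradiction (subst Prime (∣1⇒≡1 p∣1) pp) ¬prime[1]
  where
  p∣1 : p ∣ 1
  p∣1 = ∣⇒∣ᵤ (ℤ∣.∣m+n∣m⇒∣n h (ℤ∣.∣m⇒∣m*n r (∣ᵤ⇒∣ {+ p} {r} p∣r)))

-- This separates the two square roots `r` and `- r` of -1 modulo `p`, and is why the prime 2 is
-- handled apart.
odd*root-unit : ∀ {p} → Prime p → p ≢ 2 → ∀ r → + p ∣ᶻ r ℤ.* r ℤ.+ + 1 → p ∤ ∣ + 2 ℤ.* r ∣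
odd*root-unit {p} pp p≢2 r h p∣2r with euclidsLemma 2 ∣ r ∣ pp (subst (p ∣_) (ℤₚ.abs-* (+ 2) r) p∣2r)
... | inj₂ p∣r = root-unit pp r h p∣r
... | inj₁ p∣2 with prime⇒irreducible prime[2] p∣2
... | inj₁ refl = ¬prime[1] pp
... | inj₂ p≡2  = p≢2 p≡2

-- In ℤ[i] this says that the conjugate prime powers dividing a + bi may be multiplied;
-- the smaller of the two divides both a and b and is split off.
norm-∣-ordered : ∀ {p} → Prime p → p ≢ 2 → ∀ J r → + (p ^ suc J) ∣ᶻ r ℤ.* r ℤ.+ + 1 →
  ∀ {i l} a b → i ≤ l → l ≤ suc J → + (p ^ i) ∣ᶻ a ℤ.+ r ℤ.* b → + (p ^ l) ∣ᶻ a ℤ.- r ℤ.* b →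
  + (p ^ (i + l)) ∣ᶻ a ℤ.* a ℤ.+ b ℤ.* b
norm-∣-ordered {p} pp p≢2 J r h {i} a b i≤l l≤J hi hl with m≤n⇒∃[o]m+o≡n i≤l
... | m , refl = goal P∣a P∣b
  where
  instance
    _ = prime⇒nonZero pp
    _ = m^n≢0 p i
  P = + (p ^ i)
  R = + (p ^ m)
  ^-split : + (p ^ (i + m)) ≡ P ℤ.* R
  ^-split = trans (cong +_ (^-distribˡ-+-* p i m)) (ℤₚ.pos-* (p ^ i) (p ^ m))
  P∣a-rb : P ∣ᶻ a ℤ.- r ℤ.* b
  P∣a-rb = ℤ∣.∣-trans (divides R (trans ^-split (ℤₚ.*-comm P R))) hl
  p∣r²+1 : + p ∣ᶻ r ℤ.* r ℤ.+ + 1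
  p∣r²+1 = ℤ∣.∣-trans (∣ᵤ⇒∣ (m∣m*n (p ^ J))) h
  diff : ∀ a b r → (a ℤ.+ r ℤ.* b) ℤ.- (a ℤ.- r ℤ.* b) ≡ (+ 2 ℤ.* r) ℤ.* b
  diff = ℤSolver.solve-∀
  -- Both linear forms are divisible by `P`, their difference is 2rb, and 2r is prime to `p`.
  P∣b : P ∣ᶻ b
  P∣b = prime^∣ᶻ*-cancel pp i (+ 2 ℤ.* r) (odd*root-unit pp p≢2 r p∣r²+1)
          (∣ᶻ-cast (diff a b r) (ℤ∣.∣m∣n⇒∣m-n hi P∣a-rb))
  P∣a : P ∣ᶻ a
  P∣a = ℤ∣.∣m+n∣n⇒∣m hi (ℤ∣.∣n⇒∣m*n r P∣b)
  goal : P ∣ᶻ a → P ∣ᶻ b → + (p ^ (i + (i + m))) ∣ᶻ a ℤ.* a ℤ.+ b ℤ.* b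
  goal (divides a′ refl) (divides b′ refl) = ∣ᶻ-cast (collect a′ b′ P)
    (subst (_∣ᶻ P ℤ.* (P ℤ.* (a′ ℤ.* a′ ℤ.+ b′ ℤ.* b′))) (sym ^-split₂) (ℤ∣.*-monoʳ-∣ P (ℤ∣.*-monoʳ-∣ P R∣N)))
    where
    collect : ∀ a b P → P ℤ.* (P ℤ.* (a ℤ.* a ℤ.+ b ℤ.* b)) ≡ (a ℤ.* P) ℤ.* (a ℤ.* P) ℤ.+ (b ℤ.* P) ℤ.* (b ℤ.* P)
    collect = ℤSolver.solve-∀
    factor : ∀ a b P r → a ℤ.* P ℤ.- r ℤ.* (b ℤ.* P) ≡ P ℤ.* (a ℤ.- r ℤ.* b)
    factor = ℤSolver.solve-∀
    conjugates : ∀ a b r → (a ℤ.- r ℤ.* b) ℤ.* (a ℤ.+ r ℤ.* b) ℤ.+ (r ℤ.* r ℤ.+ + 1) ℤ.* (b ℤ.* b) ≡ a ℤ.* a ℤ.+ b ℤ.* b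
    conjugates = ℤSolver.solve-∀
    ^-split₂ : + (p ^ (i + (i + m))) ≡ P ℤ.* (P ℤ.* R)
    ^-split₂ = trans (cong +_ (^-distribˡ-+-* p i (i + m)))
      (trans (ℤₚ.pos-* (p ^ i) (p ^ (i + m))) (cong (P ℤ.*_) ^-split))
    R∣a′-rb′ : R ∣ᶻ a′ ℤ.- r ℤ.* b′
    R∣a′-rb′ = ℤ∣.*-cancelˡ-∣ P (subst₂ _∣ᶻ_ ^-split (factor a′ b′ P r) hl)
    R∣r²+1 : R ∣ᶻ r ℤ.* r ℤ.+ + 1
    R∣r²+1 = ℤ∣.∣-trans (∣ᵤ⇒∣ (^-monoʳ-∣ p (≤-trans (m≤n+m m i) l≤J))) h
    R∣N : R ∣ᶻ a′ ℤ.* a′ ℤ.+ b′ ℤ.* b′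
    R∣N = ∣ᶻ-cast (conjugates a′ b′ r)
      (ℤ∣.∣m∣n⇒∣m+n (ℤ∣.∣m⇒∣m*n _ R∣a′-rb′) (ℤ∣.∣m⇒∣m*n (b′ ℤ.* b′) R∣r²+1))
-- Replacing `r` by `- r` swaps the two linear forms, which reduces to the ordered case. `J = 0` is
-- separate because `p` need not divide r² + 1 there.
norm-∣ : ∀ {p} → Prime p → p ≢ 2 → ∀ J r → + (p ^ J) ∣ᶻ r ℤ.* r ℤ.+ + 1 →
  ∀ {i l} a b → i ≤ J → l ≤ J → + (p ^ i) ∣ᶻ a ℤ.+ r ℤ.* b → + (p ^ l) ∣ᶻ a ℤ.- r ℤ.* b →
  + (p ^ (i + l)) ∣ᶻ a ℤ.* a ℤ.+ b ℤ.* b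
norm-∣ pp p≢2 zero    r h a b z≤n z≤n _ _ = ∣ᵤ⇒∣ (1∣ _)
norm-∣ {p} pp p≢2 (suc J) r h {i} {l} a b i≤J l≤J hi hl with ≤-total i l
... | inj₁ i≤l = norm-∣-ordered pp p≢2 J r h a b i≤l l≤J hi hl
... | inj₂ l≤i = subst (λ e → + (p ^ e) ∣ᶻ a ℤ.* a ℤ.+ b ℤ.* b) (+-comm l i)
  (norm-∣-ordered pp p≢2 J (ℤ.- r) (∣ᶻ-cast (square r) h) a b l≤i i≤J
    (∣ᶻ-cast (plus a b r) hl) (∣ᶻ-cast (minus a b r) hi))
  where
  square : ∀ r → r ℤ.* r ℤ.+ + 1 ≡ (ℤ.- r) ℤ.* (ℤ.- r) ℤ.+ + 1
  square = ℤSolver.solve-∀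
  plus : ∀ a b r → a ℤ.- r ℤ.* b ≡ a ℤ.+ (ℤ.- r) ℤ.* b
  plus = ℤSolver.solve-∀
  minus : ∀ a b r → a ℤ.+ r ℤ.* b ≡ a ℤ.- (ℤ.- r) ℤ.* b
  minus = ℤSolver.solve-∀

-- Used as `at (t ≟ u) 1 _` in products and `at (t ≟ u) 0 _` in sums: diagonal pairs get the neutral
-- element, while the index range stays a full square.
at : ∀ {a} {A : Set a} → Dec A → ℕ → ℕ → ℕ
at (yes _) x y = x
at (no  _) x y = y

norm : ℤ → ℤ → ℕ
norm a b = ∣ a ∣ * ∣ a ∣ + ∣ b ∣ * ∣ b ∣

∣i∣*∣i∣≡i*i : ∀ i → + (∣ i ∣ * ∣ i ∣) ≡ i ℤ.* i
∣i∣*∣i∣≡i*i (+ n)        = ℤₚ.pos-* n n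
∣i∣*∣i∣≡i*i (ℤ.-[1+ n ]) = refl

norm≡ : ∀ a b → + norm a b ≡ a ℤ.* a ℤ.+ b ℤ.* b
norm≡ a b = trans (ℤₚ.pos-+ (∣ a ∣ * ∣ a ∣) (∣ b ∣ * ∣ b ∣)) (cong₂ ℤ._+_ (∣i∣*∣i∣≡i*i a) (∣i∣*∣i∣≡i*i b))

k²+1 : ℕ → ℕ
k²+1 k = suc (k * k)

k²+1≡ : ∀ k → + k²+1 k ≡ + k ℤ.* + k ℤ.+ + 1
k²+1≡ k = trans (cong +_ (+-comm 1 (k * k))) (trans (ℤₚ.pos-+ (k * k) 1) (cong (ℤ._+ + 1) (ℤₚ.pos-* k k)))

∣-diff⇒+≤ : ∀ {d k l} c → k < l → + d ∣ᶻ + k ℤ.- c → + d ∣ᶻ + l ℤ.- c → k + d ≤ l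
∣-diff⇒+≤ {d} {k} {l} c k<l hk hl = ≤-trans (+-monoʳ-≤ k (∣⇒≤ {{>-nonZero (m<n⇒0<n∸m k<l)}} d∣l∸k)) (≤-reflexive (m+[n∸m]≡n (<⇒≤ k<l)))
  where
  diff : ∀ k l c → (l ℤ.- c) ℤ.- (k ℤ.- c) ≡ l ℤ.- k
  diff = ℤSolver.solve-∀
  d∣l∸k : d ∣ l ∸ k
  d∣l∸k = ∣⇒∣ᵤ (∣ᶻ-cast (trans (diff (+ k) (+ l) c) (trans (ℤₚ.m-n≡m⊖n l k) (ℤₚ.⊖-≥ (<⇒≤ k<l)))) (ℤ∣.∣m∣n⇒∣m-n hl hk))

-- The modulus divides k² - r² = (k - r)(k + r). If `p` divided both factors it would divide their
-- difference 2r, so the whole power falls on one of them.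
roots : ∀ {p} → Prime p → p ≢ 2 → ∀ j r → + (p ^ suc j) ∣ᶻ r ℤ.* r ℤ.+ + 1 → ∀ k → p ^ suc j ∣ k²+1 k →
  + (p ^ suc j) ∣ᶻ + k ℤ.- r ⊎ + (p ^ suc j) ∣ᶻ + k ℤ.- ℤ.- r
roots {p} pp p≢2 j r hr k hk = distribute (prime^∣ᶻ*-split pp (suc j) (+ k ℤ.- r) (+ k ℤ.- ℤ.- r)
    (∣ᶻ-cast (conj (+ k) r) (ℤ∣.∣m∣n⇒∣m-n (∣ᶻ-cast (k²+1≡ k) (∣ᵤ⇒∣ hk)) hr)))
  where
  conj : ∀ k r → (k ℤ.* k ℤ.+ + 1) ℤ.- (r ℤ.* r ℤ.+ + 1) ≡ (k ℤ.- r) ℤ.* (k ℤ.- ℤ.- r)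
  conj = ℤSolver.solve-∀
  diff : ∀ k r → (k ℤ.- ℤ.- r) ℤ.- (k ℤ.- r) ≡ + 2 ℤ.* r
  diff = ℤSolver.solve-∀
  p∣ : ∀ e {x} → + (p ^ suc e) ∣ᶻ x → + p ∣ᶻ x
  p∣ e = ℤ∣.∣-trans (∣ᵤ⇒∣ (m∣m*n (p ^ e)))
  distribute : (∃₂ λ i l → i + l ≡ suc j × + (p ^ i) ∣ᶻ + k ℤ.- r × + (p ^ l) ∣ᶻ + k ℤ.- ℤ.- r) →
    + (p ^ suc j) ∣ᶻ + k ℤ.- r ⊎ + (p ^ suc j) ∣ᶻ + k ℤ.- ℤ.- r
  distribute (zero  , l     , refl , _ , y) = inj₂ y
  distribute (suc i , zero  , eq   , x , _) =
    inj₁ (subst (λ e → + (p ^ e) ∣ᶻ + k ℤ.- r) (trans (sym (+-identityʳ (suc i))) eq) x)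
  distribute (suc i , suc l , _    , x , y) = contradiction
    (∣⇒∣ᵤ (∣ᶻ-cast (diff (+ k) r) (ℤ∣.∣m∣n⇒∣m-n (p∣ l y) (p∣ i x)))) (odd*root-unit pp p≢2 r (p∣ j hr))

rootCount : ℕ → ℕ → ℕ
rootCount n d = ∑ n (λ k → ⟦ d ∣? k²+1 (suc k) ⟧)

-- The roots lie in the two classes of `r` and `- r`, and members of one class are at least d =
-- p^(j+1) apart, so each class contributes at most n/d + 1.
rootCount≤ : ∀ {p} → Prime p → p ≢ 2 → ∀ j r → + (p ^ suc j) ∣ᶻ r ℤ.* r ℤ.+ + 1 → ∀ n →
  p ^ suc j * rootCount n (p ^ suc j) ≤ 2 * (n + p ^ suc j)
rootCount≤ {p} pp p≢2 j r hr n = begin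
  d * rootCount n d
    ≤⟨ *-monoʳ-≤ d (∑-mono n λ {k} _ → ⟦⟧-⊎ (d ∣? k²+1 (suc k)) (near? r k) (near? (ℤ.- r) k) (roots pp p≢2 j r hr (suc k))) ⟩
  d * ∑ n (λ k → ⟦ near? r k ⟧ + ⟦ near? (ℤ.- r) k ⟧)
    ≡⟨ trans (cong (d *_) (∑-+ n _ _)) (*-distribˡ-+ d _ _) ⟩
  d * ∑ n (λ k → ⟦ near? r k ⟧) + d * ∑ n (λ k → ⟦ near? (ℤ.- r) k ⟧)
    ≤⟨ +-mono-≤ (count r) (count (ℤ.- r)) ⟩
  (n + d) + (n + d)
    ≡⟨ cong (λ z → n + d + z) (sym (+-identityʳ (n + d))) ⟩
  2 * (n + d) ∎
  where
  open ≤-Reasoning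
  d = p ^ suc j
  near? : ∀ c k → Dec (+ d ∣ᶻ + suc k ℤ.- c)
  near? c k = + d ℤ∣.∣? (+ suc k ℤ.- c)
  count : ∀ c → d * ∑ n (λ k → ⟦ near? c k ⟧) ≤ n + d
  count c = separated-count (near? c) d n λ k<l _ hk hl → s≤s⁻¹ (∣-diff⇒+≤ c (s≤s k<l) hk hl)

-- The smaller of two roots serves as `r`. The sum of two distinct roots is below 2n and so not
-- divisible by the modulus d; hence their difference is, and two roots would force d ≤ n.
rootCount≤1 : ∀ {p} → Prime p → p ≢ 2 → ∀ j n → n + n < p ^ suc j → rootCount n (p ^ suc j) ≤ 1
rootCount≤1 {p} pp p≢2 j n 2n<d = ≮⇒≥ λ 1<c → <⇒≱ 2n<d (+-cancelʳ-≤ d _ _ (begin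
  d + d                   ≡⟨ eq d ⟩
  d * 2                   ≤⟨ *-monoʳ-≤ d 1<c ⟩
  d * rootCount n d       ≤⟨ separated-count (λ k → d ∣? k²+1 (suc k)) d n sep ⟩
  n + d                   ≤⟨ +-monoˡ-≤ d (m≤m+n n n) ⟩
  n + n + d               ∎))
  where
  open ≤-Reasoning
  d = p ^ suc j
  eq : ∀ d → d + d ≡ d * 2
  eq = solve-∀
  sep : ∀ {k l} → k < l → l < n → d ∣ k²+1 (suc k) → d ∣ k²+1 (suc l) → k + d ≤ l
  sep {k} {l} k<l l<n hk hl = [ near , far ]′
    (roots pp p≢2 j (+ suc k) (∣ᶻ-cast (k²+1≡ (suc k)) (∣ᵤ⇒∣ hk)) (suc l) hl)
    where
    near : + d ∣ᶻ + suc l ℤ.- + suc k → k + d ≤ l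
    near h = s≤s⁻¹ (∣-diff⇒+≤ (+ suc k) (s≤s k<l) (∣ᶻ-cast (sym (ℤₚ.+-inverseʳ (+ suc k))) (∣ᵤ⇒∣ (d ∣0))) h)
    far : + d ∣ᶻ + suc l ℤ.- ℤ.- + suc k → k + d ≤ l
    far h = contradiction (∣⇒≤ {n = suc l + suc k} (∣⇒∣ᵤ h)) (<⇒≱ (≤-<-trans (+-mono-≤ l<n (<-trans k<l l<n)) 2n<d))

-- Differences of Gaussian integers

-- Needed because a pair `t = u` has difference 0, which every prime power divides; each of these
-- `n` pairs costs at most `B`.
∑-off-diagonal : ∀ n B (s : ℕ → ℕ → ℕ) → (∀ t u → s t u ≤ B) →
  ∑ n (λ t → ∑ n (s t)) ≤ ∑ n (λ t → ∑ n (λ u → at (t ≟ u) 0 (s t u))) + n * B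
∑-off-diagonal n B s s≤B = begin
  ∑ n (λ t → ∑ n (s t))
    ≤⟨ ∑-mono n (λ {t} t<n → row t t<n) ⟩
  ∑ n (λ t → ∑ n (λ u → at (t ≟ u) 0 (s t u)) + B)
    ≡⟨ ∑-+ n _ _ ⟩
  ∑ n (λ t → ∑ n (λ u → at (t ≟ u) 0 (s t u))) + ∑ n (λ _ → B)
    ≡⟨ cong (λ z → ∑ n (λ t → ∑ n (λ u → at (t ≟ u) 0 (s t u))) + z) (∑-const n B) ⟩
  ∑ n (λ t → ∑ n (λ u → at (t ≟ u) 0 (s t u))) + n * B ∎
  where
  open ≤-Reasoning
  cell : ∀ t u → s t u ≤ at (t ≟ u) 0 (s t u) + ⟦ t ≟ u ⟧ * B
  cell t u with t ≟ u
  ... | yes _ = ≤-trans (s≤B t u) (m≤m+n B 0)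
  ... | no  _ = m≤m+n _ _
  row : ∀ t → t < n → ∑ n (s t) ≤ ∑ n (λ u → at (t ≟ u) 0 (s t u)) + B
  row t t<n = ≤-trans (∑-mono n λ {u} _ → cell t u)
    (≤-reflexive (trans (∑-+ n _ _) (cong (λ z → ∑ n (λ u → at (t ≟ u) 0 (s t u)) + z) (∑-select n (λ _ → B) t<n))))

%ℕ-≡⇒∣ : ∀ d .{{_ : NonZero d}} a b → a %ℕ d ≡ b %ℕ d → + d ∣ᶻ a ℤ.- b
%ℕ-≡⇒∣ d a b eq = divides ((a /ℕ d) ℤ.- (b /ℕ d)) (begin
  a ℤ.- b
    ≡⟨ cong₂ ℤ._-_ (a≡a%ℕn+[a/ℕn]*n a d) (a≡a%ℕn+[a/ℕn]*n b d) ⟩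
  (+ (a %ℕ d) ℤ.+ (a /ℕ d) ℤ.* + d) ℤ.- (+ (b %ℕ d) ℤ.+ (b /ℕ d) ℤ.* + d)
    ≡⟨ cong (λ z → (+ z ℤ.+ (a /ℕ d) ℤ.* + d) ℤ.- (+ (b %ℕ d) ℤ.+ (b /ℕ d) ℤ.* + d)) eq ⟩
  (+ (b %ℕ d) ℤ.+ (a /ℕ d) ℤ.* + d) ℤ.- (+ (b %ℕ d) ℤ.+ (b /ℕ d) ℤ.* + d)
    ≡⟨ cancel (+ (b %ℕ d)) (a /ℕ d) (b /ℕ d) (+ d) ⟩
  ((a /ℕ d) ℤ.- (b /ℕ d)) ℤ.* + d ∎)
  where
  open ≡-Reasoning
  cancel : ∀ r q q′ d → (r ℤ.+ q ℤ.* d) ℤ.- (r ℤ.+ q′ ℤ.* d) ≡ (q ℤ.- q′) ℤ.* d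
  cancel = ℤSolver.solve-∀

module _ (n : ℕ) (x y : ℕ → ℤ) where

  -- For c² ≡ -1 modulo d this is the image of z_t - z_u under the ring map from ℤ[i] to ℤ/d sending
  -- i to c; c = r and c = -r give the two conjugate prime powers.
  Δ : ℤ → ℕ → ℕ → ℤ
  Δ c t u = (x t ℤ.- x u) ℤ.+ c ℤ.* (y t ℤ.- y u)

  pairNorm : ℕ → ℕ → ℕ
  pairNorm t u = norm (x t ℤ.- x u) (y t ℤ.- y u)

  -- The norm of the discriminant of the points z_t, taken over ordered pairs.
  normProduct : ℕ
  normProduct = ∏ n (λ t → ∏ n (λ u → at (t ≟ u) 1 (pairNorm t u)))

  hits : ℤ → ℕ → ℕ
  hits c d = ∑ n (λ t → ∑ n (λ u → ⟦ d ∣? ∣ Δ c t u ∣ ⟧))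

  hits≥ : ∀ c d .{{_ : NonZero d}} → n * n ≤ d * hits c d
  hits≥ c d = ≤-trans (collisions n d residue (λ {t} _ → n%ℕd<d (point t) d))
    (*-monoʳ-≤ d (∑-mono n λ {t} _ → ∑-mono n λ {u} _ →
      ⟦⟧-mono (residue t ≟ residue u) (d ∣? ∣ Δ c t u ∣) λ eq →
        ∣⇒∣ᵤ (∣ᶻ-cast (linear (x t) (x u) c (y t) (y u)) (%ℕ-≡⇒∣ d (point t) (point u) eq))))
    where
    point : ℕ → ℤ
    point t = x t ℤ.+ c ℤ.* y t
    residue : ℕ → ℕ
    residue t = point t %ℕ d
    linear : ∀ a a′ c b b′ → (a ℤ.+ c ℤ.* b) ℤ.- (a′ ℤ.+ c ℤ.* b′) ≡ (a ℤ.- a′) ℤ.+ c ℤ.* (b ℤ.- b′)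
    linear = ℤSolver.solve-∀

  -- At each level d = pʲ, n times the root count is at most 2n²/d + 2n, and by `hits≥` the two
  -- kinds of hits already supply 2n²/d. Summing hits over levels gives valuations truncated at `J`.
  -- The error is 2n per level, plus 2J for each of the `n` diagonal pairs.
  normProduct-val : ∀ {p} → Prime p → p ≢ 2 → ∀ J r → + (p ^ J) ∣ᶻ r ℤ.* r ℤ.+ + 1 →
    ∃ λ W → p ^ W ∣ normProduct × n * ∑ J (λ j → rootCount n (p ^ suc j)) ≤ W + 4 * (J * n)
  normProduct-val {p} pp p≢2 J r hr = W , W∣ , (begin
    n * ∑ J (λ j → rootCount n (p ^ suc j))
      ≡⟨ sym (∑-*ˡ J n _) ⟩
    ∑ J (λ j → n * rootCount n (p ^ suc j))
      ≤⟨ ∑-mono J count ⟩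
    ∑ J (λ j → hits r (p ^ suc j) + hits (ℤ.- r) (p ^ suc j) + 2 * n)
      ≡⟨ trans (∑-+ J _ _) (cong₂ _+_ (∑-+ J _ _) (∑-const J (2 * n))) ⟩
    ∑ J (λ j → hits r (p ^ suc j)) + ∑ J (λ j → hits (ℤ.- r) (p ^ suc j)) + J * (2 * n)
      ≡⟨ cong (_+ J * (2 * n)) (trans (cong₂ _+_ (∑-hits r) (∑-hits (ℤ.- r)))
           (sym (trans (∑-cong n (λ _ → ∑-+ n _ _)) (∑-+ n _ _)))) ⟩
    ∑ n (λ t → ∑ n (λ u → s t u)) + J * (2 * n)
      ≤⟨ +-monoˡ-≤ (J * (2 * n)) (∑-off-diagonal n (J + J) s λ t u → +-mono-≤ (val≤ p J _) (val≤ p J _)) ⟩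
    W + n * (J + J) + J * (2 * n)
      ≡⟨ collect W J n ⟩
    W + 4 * (J * n) ∎)
    where
    open ≤-Reasoning
    instance _ = prime⇒nonZero pp
    collect : ∀ W J n → W + n * (J + J) + J * (2 * n) ≡ W + 4 * (J * n)
    collect = solve-∀
    v : ℤ → ℕ → ℕ → ℕ
    v c t u = val p J ∣ Δ c t u ∣
    s : ℕ → ℕ → ℕ
    s t u = v r t u + v (ℤ.- r) t u
    W : ℕ
    W = ∑ n (λ t → ∑ n (λ u → at (t ≟ u) 0 (s t u)))
    minus : ∀ a b r → a ℤ.+ (ℤ.- r) ℤ.* b ≡ a ℤ.- r ℤ.* b
    minus = ℤSolver.solve-∀
    norm∣ : ∀ t u → p ^ s t u ∣ pairNorm t u
    norm∣ t u = ∣⇒∣ᵤ (∣ᶻ-cast (sym (norm≡ a b)) (norm-∣ pp p≢2 J r hr a b (val≤ p J _) (val≤ p J _)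
      (∣ᵤ⇒∣ (^val∣ p J ∣ Δ r t u ∣))
      (∣ᶻ-cast (minus a b r) (∣ᵤ⇒∣ (^val∣ p J ∣ Δ (ℤ.- r) t u ∣)))))
      where
      a = x t ℤ.- x u
      b = y t ℤ.- y u
    cell : ∀ t u → p ^ at (t ≟ u) 0 (s t u) ∣ at (t ≟ u) 1 (pairNorm t u)
    cell t u with t ≟ u
    ... | yes _ = ∣-refl
    ... | no  _ = norm∣ t u
    W∣ : p ^ W ∣ normProduct
    W∣ = ∏-^∣ n p λ {t} _ → ∏-^∣ n p λ {u} _ → cell t u
    ∑-hits : ∀ c → ∑ J (λ j → hits c (p ^ suc j)) ≡ ∑ n (λ t → ∑ n (λ u → v c t u))
    ∑-hits c = trans (∑-swap J n _) (∑-cong n λ {t} _ → ∑-swap J n _)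
    count : ∀ {j} → j < J → n * rootCount n (p ^ suc j) ≤ hits r (p ^ suc j) + hits (ℤ.- r) (p ^ suc j) + 2 * n
    count {j} j<J = *-cancelˡ-≤ d (begin
      d * (n * rootCount n d)              ≡⟨ swap d n (rootCount n d) ⟩
      n * (d * rootCount n d)              ≤⟨ *-monoʳ-≤ n (rootCount≤ pp p≢2 j r (ℤ∣.∣-trans (∣ᵤ⇒∣ (^-monoʳ-∣ p j<J)) hr) n) ⟩
      n * (2 * (n + d))                    ≡⟨ expand n d ⟩
      n * n + n * n + d * (2 * n)          ≤⟨ +-monoˡ-≤ (d * (2 * n)) (+-mono-≤ (hits≥ r d) (hits≥ (ℤ.- r) d)) ⟩
      d * hits r d + d * hits (ℤ.- r) d + d * (2 * n)
                                           ≡⟨ factor d (hits r d) (hits (ℤ.- r) d) (2 * n) ⟩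
      d * (hits r d + hits (ℤ.- r) d + 2 * n) ∎)
      where
      d = p ^ suc j
      instance _ = m^n≢0 p (suc j)
      swap : ∀ a b c → a * (b * c) ≡ b * (a * c)
      swap = solve-∀
      expand : ∀ n d → n * (2 * (n + d)) ≡ n * n + n * n + d * (2 * n)
      expand = solve-∀
      factor : ∀ d a b c → d * a + d * b + d * c ≡ d * (a + b + c)
      factor = solve-∀

-- Large prime factors of ∏ (k² + 1)

-- Squares are 0 or 1 modulo 4. Hence 2 divides each factor of the product at most once, and the
-- prime 2 needs no counting argument.
4∤k²+1 : ∀ k → 4 ∤ k²+1 k
4∤k²+1 k 4∣ with even⊎odd k
... | m , inj₁ refl = contradiction (∣m+n∣m⇒∣n (subst (4 ∣_) (eq m) 4∣) (m∣m*n (m * m))) (>⇒∤ (s≤s (s≤s z≤n)))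
  where
  eq : ∀ m → suc ((m + m) * (m + m)) ≡ 4 * (m * m) + 1
  eq = solve-∀
... | m , inj₂ refl = contradiction (∣m+n∣m⇒∣n (subst (4 ∣_) (eq m) 4∣) (m∣m*n (m * m + m))) (>⇒∤ (s≤s (s≤s (s≤s z≤n))))
  where
  eq : ∀ m → suc (suc (m + m) * suc (m + m)) ≡ 4 * (m * m + m) + 2
  eq = solve-∀

∑>0⇒∃ : ∀ n f → ∑ n f ≢ 0 → ∃ λ i → i < n × f i ≢ 0
∑>0⇒∃ zero    f h = contradiction refl h
∑>0⇒∃ (suc n) f h with f n ≟ 0
... | no fn≢0 = n , ≤-refl , fn≢0
... | yes fn≡0 with ∑>0⇒∃ n f (λ s≡0 → h (cong₂ _+_ s≡0 fn≡0))
... | i , i<n , fi≢0 = i , m<n⇒m<1+n i<n , fi≢0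

⟦⟧≢0⇒ : ∀ {a} {A : Set a} (A? : Dec A) → ⟦ A? ⟧ ≢ 0 → A
⟦⟧≢0⇒ (yes a) _ = a
⟦⟧≢0⇒ (no _)  h = contradiction refl h

∣⊝∣≤ : ∀ m n → ∣ + m ℤ.- + n ∣ ≤ m ⊔ n
∣⊝∣≤ m n = subst (λ z → ∣ z ∣ ≤ m ⊔ n) (sym (ℤₚ.m-n≡m⊖n m n)) (ℤₚ.∣m⊝n∣≤m⊔n m n)

n!²≤∏ : ∀ n → n ! * n ! ≤ ∏ n (λ k → k²+1 (suc k))
n!²≤∏ zero    = ≤-refl
n!²≤∏ (suc n) = begin
  suc n * n ! * (suc n * n !)   ≡⟨ eq (suc n) (n !) ⟩
  n ! * n ! * (suc n * suc n)   ≤⟨ *-mono-≤ (n!²≤∏ n) (n≤1+n _) ⟩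
  ∏ (suc n) (λ k → k²+1 (suc k)) ∎
  where
  open ≤-Reasoning
  eq : ∀ a b → a * b * (a * b) ≡ b * b * (a * a)
  eq = solve-∀

^-distribʳ-* : ∀ a b n → (a * b) ^ n ≡ a ^ n * b ^ n
^-distribʳ-* a b zero    = refl
^-distribʳ-* a b (suc n) = trans (cong (a * b *_) (^-distribʳ-* a b n)) (shuffle a b (a ^ n) (b ^ n))
  where
  shuffle : ∀ a b c d → a * b * (c * d) ≡ a * c * (b * d)
  shuffle = solve-∀

^-cancelˡ-≤ : ∀ {a b} n .{{_ : NonZero n}} → a ^ n ≤ b ^ n → a ≤ b
^-cancelˡ-≤ n h = ≮⇒≥ λ b<a → <⇒≱ (^-monoˡ-< n b<a) h

^-monoˡ-∣ : ∀ {a b} n → a ∣ b → a ^ n ∣ b ^ n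
^-monoˡ-∣ zero    h = ∣-refl
^-monoˡ-∣ (suc n) h = *-pres-∣ h (^-monoˡ-∣ n h)

module Smooth (n h : ℕ) (4^h≤n : 4 ^ h ≤ n) (n<4^[1+h] : n < 4 ^ suc h)
  (smooth : ∀ {p} → Prime p → ∀ {k} → k < n → p ∣ k²+1 (suc k) → p ≤ n + n) where

  -- `M` replaces the square root of `n` by a power of two: M² = 4^(h+1) lies above `n` and is at
  -- most 4n. `T = 2 * M` separates small from large primes, with T² > 2n, and `2 ^ L` bounds every
  -- k² + 1.
  M T L : ℕ
  M = 2 ^ suc h
  T = 2 ^ suc (suc h)
  L = 4 * suc h

  P : ℕ
  P = ∏ n (λ k → k²+1 (suc k))

  instance
    M≢0 : NonZero M
    M≢0 = m^n≢0 2 (suc h)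
    n≢0 : NonZero n
    n≢0 = >-nonZero (≤-trans (m^n>0 4 h) 4^h≤n)

  M*M≡ : M * M ≡ 4 ^ suc h
  M*M≡ = sym (^-distribʳ-* 2 2 (suc h))

  -- The base-`M` digits of `t` are the coordinates, so distinct `t` below `n` give distinct points
  -- of an `M` by `M` box.
  x y : ℕ → ℤ
  x t = + (t div M)
  y t = + (t % M)

  x<M : ∀ {t} → t < n → t div M < M
  x<M {t} t<n = m<n*o⇒m/o<n (subst (t <_) (sym M*M≡) (<-trans t<n n<4^[1+h]))

  G : ℕ
  G = normProduct n x y

  ∣x∣≤M : ∀ {t u} → t < n → u < n → ∣ x t ℤ.- x u ∣ ≤ M
  ∣x∣≤M {t} {u} t<n u<n = ≤-trans (∣⊝∣≤ (t div M) (u div M)) (⊔-lub (<⇒≤ (x<M t<n)) (<⇒≤ (x<M u<n)))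

  ∣y∣≤M : ∀ t u → ∣ y t ℤ.- y u ∣ ≤ M
  ∣y∣≤M t u = ≤-trans (∣⊝∣≤ (t % M) (u % M)) (⊔-lub (<⇒≤ (m%n<n t M)) (<⇒≤ (m%n<n u M)))

  pairNorm≤ : ∀ {t u} → t < n → u < n → pairNorm n x y t u ≤ 8 * n
  pairNorm≤ {t} {u} t<n u<n = begin
    pairNorm n x y t u         ≤⟨ +-mono-≤ (*-mono-≤ (∣x∣≤M t<n u<n) (∣x∣≤M t<n u<n)) (*-mono-≤ (∣y∣≤M t u) (∣y∣≤M t u)) ⟩
    M * M + M * M              ≡⟨ cong₂ _+_ M*M≡ M*M≡ ⟩
    4 ^ suc h + 4 ^ suc h      ≡⟨ eq (4 ^ h) ⟩
    8 * 4 ^ h                  ≤⟨ *-monoʳ-≤ 8 4^h≤n ⟩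
    8 * n                      ∎
    where
    open ≤-Reasoning
    eq : ∀ a → 4 * a + 4 * a ≡ 8 * a
    eq = solve-∀

  pairNorm>0 : ∀ {t u} → t ≢ u → 0 < pairNorm n x y t u
  pairNorm>0 {t} {u} t≢u = n≢0⇒n>0 λ N≡0 → t≢u (begin
    t                       ≡⟨ m≡m%n+[m/n]*n t M ⟩
    t % M + (t div M) * M     ≡⟨ cong₂ (λ a b → a + b * M)
                                 (same {t % M} {u % M} (m+n≡0⇒n≡0 (∣ x t ℤ.- x u ∣ * ∣ x t ℤ.- x u ∣) N≡0))
                                 (same {t div M} {u div M} (m+n≡0⇒m≡0 _ N≡0)) ⟩
    u % M + (u div M) * M     ≡⟨ sym (m≡m%n+[m/n]*n u M) ⟩
    u                       ∎)
    where
    open ≡-Reasoning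
    same : ∀ {a b} → ∣ + a ℤ.- + b ∣ * ∣ + a ℤ.- + b ∣ ≡ 0 → a ≡ b
    same {a} {b} sq≡0 with m*n≡0⇒m≡0∨n≡0 ∣ + a ℤ.- + b ∣ sq≡0
    ... | inj₁ z = ℤₚ.+-injective (ℤₚ.i-j≡0⇒i≡j (+ a) (+ b) (ℤₚ.∣i∣≡0⇒i≡0 z))
    ... | inj₂ z = ℤₚ.+-injective (ℤₚ.i-j≡0⇒i≡j (+ a) (+ b) (ℤₚ.∣i∣≡0⇒i≡0 z))

  G≤ : G ≤ ((8 * n) ^ n) ^ n
  G≤ = ≤-trans (∏-mono n λ {t} t<n → ≤-trans (∏-mono n λ {u} u<n → cell t u t<n u<n) (≤-reflexive (∏-const n (8 * n))))
               (≤-reflexive (∏-const n ((8 * n) ^ n)))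
    where
    cell : ∀ t u → t < n → u < n → at (t ≟ u) 1 (pairNorm n x y t u) ≤ 8 * n
    cell t u t<n u<n with t ≟ u
    ... | yes _ = m≤n⇒m≤n+o _ (>-nonZero⁻¹ n)
    ... | no  _ = pairNorm≤ t<n u<n

  G>0 : 0 < G
  G>0 = ∏>0 n λ {t} _ → ∏>0 n λ {u} _ → cell t u
    where
    cell : ∀ t u → 0 < at (t ≟ u) 1 (pairNorm n x y t u)
    cell t u with t ≟ u
    ... | yes _  = ≤-refl
    ... | no t≢u = pairNorm>0 t≢u

  -- Each power pʲ ≤ p^L costs an error 4n in the comparison of Pⁿ with G. A prime p > T has
  -- p⁴ ∤ k² + 1, and p², p³ > 2n each divide at most one factor of P, hence 4 + 1 + 1.
  E : ℕ
  E = 2 ^ n * (((n + n) #) ^ 6 * (T #) ^ (4 * L))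

  -- `normProduct-val` needs a square root of -1 modulo the top power. Levels without a root among
  -- 1, ..., n contribute nothing, so `J` is lowered until a counted root can serve as `r`.
  root-val : ∀ {p} → Prime p → p ≢ 2 → ∀ J →
    ∃ λ W → p ^ W ∣ G × n * ∑ J (λ j → rootCount n (p ^ suc j)) ≤ W + 4 * (J * n)
  root-val pp p≢2 zero = 0 , 1∣ G , ≤-reflexive (*-zeroʳ n)
  root-val {p} pp p≢2 (suc J) with rootCount n (p ^ suc J) ≟ 0
  ... | yes c≡0 = let W , W∣ , b = root-val pp p≢2 J in W , W∣ , (begin
    n * (∑ J (λ j → rootCount n (p ^ suc j)) + rootCount n (p ^ suc J))
      ≡⟨ cong (n *_) (trans (cong (λ z → ∑ J (λ j → rootCount n (p ^ suc j)) + z) c≡0) (+-identityʳ _)) ⟩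
    n * ∑ J (λ j → rootCount n (p ^ suc j)) ≤⟨ b ⟩
    W + 4 * (J * n)                         ≤⟨ +-monoʳ-≤ W (*-monoʳ-≤ 4 (m≤n+m (J * n) n)) ⟩
    W + 4 * (suc J * n)                     ∎)
    where
    open ≤-Reasoning
  ... | no c≢0 = let k , k<n , ≢0 = ∑>0⇒∃ n _ c≢0 in
    normProduct-val n x y pp p≢2 (suc J) (+ suc k)
      (∣ᶻ-cast (k²+1≡ (suc k)) (∣ᵤ⇒∣ (⟦⟧≢0⇒ (p ^ suc J ∣? k²+1 (suc k)) ≢0)))

  k²+1≤ : ∀ {k} → k < n → k²+1 (suc k) ≤ 4 ^ suc h * 4 ^ suc h
  k²+1≤ {k} k<n = begin
    suc (suc k * suc k)   ≤⟨ s≤s (*-mono-≤ k<n k<n) ⟩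
    suc (n * n)           ≤⟨ s≤s (m≤m+n _ (n + n)) ⟩
    suc (n * n + (n + n)) ≡⟨ eq n ⟩
    suc n * suc n         ≤⟨ *-mono-≤ n<4^[1+h] n<4^[1+h] ⟩
    4 ^ suc h * 4 ^ suc h ∎
    where
    open ≤-Reasoning
    eq : ∀ n → suc (n * n + (n + n)) ≡ suc n * suc n
    eq = solve-∀

  -- Summing valuations over the factors of `P` and exchanging the sums counts roots level by level;
  -- p^(L+1) exceeds every factor, so truncating at `L` loses nothing.
  Val≤-P : ∀ {p} → Prime p → ∀ L → 4 ^ suc h * 4 ^ suc h < p ^ suc L →
    Val≤ p P (∑ L (λ j → rootCount n (p ^ suc j)))
  Val≤-P {p} pp L big = subst (Val≤ p P) (∑-swap n L _)
    (Val≤-∏ pp n λ {k} k<n → Val≤-val p L (>⇒∤ (≤-<-trans (k²+1≤ k<n) big)))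

  -- Of the `e` factors `p`, `G` takes `W` and each of the `n` copies of `E` takes `c`.
  absorb : ∀ {p} .{{_ : NonZero p}} → ∀ {e} W c → p ^ W ∣ G → p ^ c ∣ E → e ≤ W + c * n → p ^ e ∣ G * E ^ n
  absorb {p} {e} W c W∣ c∣ e≤ = ∣-trans (^-monoʳ-∣ p e≤)
    (∣-trans (∣-reflexive (trans (^-distribˡ-+-* p W (c * n)) (cong (p ^ W *_) (sym (^-*-assoc p c n)))))
             (*-pres-∣ W∣ (^-monoˡ-∣ n c∣)))

  2^L≡ : 2 ^ L ≡ 4 ^ suc h * 4 ^ suc h
  2^L≡ = trans (sym (^-*-assoc 2 4 (suc h))) (^-distribʳ-* 4 4 (suc h))

  small-primes : ∀ {p} → Prime p → p ≢ 2 → p ≤ T → ∀ e → p ^ e ∣ P ^ n → p ^ e ∣ G * E ^ n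
  small-primes {p} pp p≢2 p≤T e p^e∣ with root-val pp p≢2 L
  ... | W , W∣ , b = absorb W (4 * L) W∣ (∣n⇒∣m*n (2 ^ n) (∣n⇒∣m*n (((n + n) #) ^ 6) (^-monoˡ-∣ (4 * L) (prime∣# pp p≤T))))
    (≤-trans (Val≤-^ pp n (Val≤-P pp L big) e p^e∣) (≤-trans b (≤-reflexive (cong (λ z → W + z) (sym (*-assoc 4 L n))))))
    where
    instance _ = prime⇒nonZero pp
    big : 4 ^ suc h * 4 ^ suc h < p ^ suc L
    big = <-≤-trans (subst (_< 2 ^ suc L) 2^L≡ (^-monoʳ-< 2 (s≤s (s≤s z≤n)) (n<1+n L)))
                    (^-monoˡ-≤ (suc L) (nonTrivial⇒n>1 p {{prime⇒nonTrivial pp}}))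

  n+n<T*T : n + n < T * T
  n+n<T*T = begin-strict
    n + n                 <⟨ +-mono-< n<4^[1+h] n<4^[1+h] ⟩
    4 ^ suc h + 4 ^ suc h ≤⟨ m≤m+n _ (4 ^ suc h + 4 ^ suc h) ⟩
    4 ^ suc h + 4 ^ suc h + (4 ^ suc h + 4 ^ suc h) ≡⟨ cong (λ z → z + z + (z + z)) (sym M*M≡) ⟩
    M * M + M * M + (M * M + M * M) ≡⟨ eq M ⟩
    T * T                 ∎
    where
    open ≤-Reasoning
    eq : ∀ m → m * m + m * m + (m * m + m * m) ≡ 2 * m * (2 * m)
    eq = solve-∀

  large-primes : ∀ {p} → Prime p → p ≢ 2 → T < p → p ≤ n + n → ∀ e → p ^ e ∣ P ^ n → p ^ e ∣ G * E ^ n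
  large-primes {p} pp p≢2 T<p p≤2n e p^e∣ with root-val pp p≢2 1
  ... | W , W∣ , b = absorb W 6 W∣ (∣n⇒∣m*n (2 ^ n) (∣m⇒∣m*n ((T #) ^ (4 * L)) (^-monoˡ-∣ 6 (prime∣# pp p≤2n))))
    (begin
      e                                ≤⟨ Val≤-^ pp n (Val≤-P pp 3 big) e p^e∣ ⟩
      n * (∑ 1 c + c 1 + c 2)          ≤⟨ *-monoʳ-≤ n (+-mono-≤ (+-monoʳ-≤ (∑ 1 c) (once 1 (s≤s z≤n))) (once 2 (s≤s z≤n))) ⟩
      n * (∑ 1 c + 1 + 1)              ≡⟨ expand n (∑ 1 c) ⟩
      n * ∑ 1 c + 2 * n                ≤⟨ +-monoˡ-≤ (2 * n) b ⟩
      W + 4 * (1 * n) + 2 * n          ≡⟨ collect W n ⟩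
      W + 6 * n                        ∎)
    where
    open ≤-Reasoning
    instance _ = prime⇒nonZero pp
    c : ℕ → ℕ
    c j = rootCount n (p ^ suc j)
    expand : ∀ n s → n * (s + 1 + 1) ≡ n * s + 2 * n
    expand = solve-∀
    collect : ∀ W n → W + 4 * (1 * n) + 2 * n ≡ W + 6 * n
    collect = solve-∀
    M<p : M < p
    M<p = ≤-<-trans (m≤m+n M (M + 0)) T<p
    fourth : ∀ m → m * (m * (m * (m * 1))) ≡ m * m * (m * m)
    fourth = solve-∀
    big : 4 ^ suc h * 4 ^ suc h < p ^ 4
    big = subst (_< p ^ 4) (trans (fourth M) (cong₂ _*_ M*M≡ M*M≡)) (^-monoˡ-< 4 M<p)
    once : ∀ j → 1 ≤ j → c j ≤ 1
    once j 1≤j = rootCount≤1 pp p≢2 j n (<-≤-trans n+n<T*T (begin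
      T * T     ≤⟨ *-mono-≤ (<⇒≤ T<p) (<⇒≤ T<p) ⟩
      p * p     ≡⟨ cong (p *_) (sym (*-identityʳ p)) ⟩
      p ^ 2     ≤⟨ ^-monoʳ-≤ p (s≤s 1≤j) ⟩
      p ^ suc j ∎))

  prime-2 : ∀ e → 2 ^ e ∣ P ^ n → 2 ^ e ∣ G * E ^ n
  prime-2 e 2^e∣ = absorb 0 n (1∣ G) (m∣m*n _)
    (≤-trans (Val≤-^ prime[2] n (Val≤-∏ prime[2] n {v = λ _ → 1} λ {k} _ → once (suc k)) e 2^e∣)
             (≤-reflexive (cong (n *_) (trans (∑-const n 1) (*-identityʳ n)))))
    where
    once : ∀ k → Val≤ 2 (k²+1 k) 1
    once k 0             _ = z≤n
    once k 1             _ = ≤-refl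
    once k (suc (suc e)) d = contradiction (∣-trans (^-monoʳ-∣ 2 {2} {suc (suc e)} (s≤s (s≤s z≤n))) d) (4∤k²+1 k)

  P^n∣ : P ^ n ∣ G * E ^ n
  P^n∣ = ∣-by-primePowers (P ^ n) {{m^n≢0 P n {{>-nonZero (∏>0 n λ _ → s≤s z≤n)}}}} prime-by-prime
    where
    prime-by-prime : ∀ {p} → Prime p → ∀ e → p ^ e ∣ P ^ n → p ^ e ∣ G * E ^ n
    prime-by-prime {p} pp e p^e∣ with p ≟ 2 | p ≤? T | p ≤? n + n
    ... | yes refl | _       | _        = prime-2 e p^e∣
    ... | no p≢2   | yes p≤T | _        = small-primes pp p≢2 p≤T e p^e∣
    ... | no p≢2   | no p≰T  | yes p≤2n = large-primes pp p≢2 (≰⇒> p≰T) p≤2n e p^e∣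
    ... | no p≢2   | no _    | no p≰2n  = absorb {{prime⇒nonZero pp}} 0 0 (1∣ G) (1∣ E)
      (≤-trans (Val≤-^ pp n (Val≤-∏ pp n {v = λ _ → 0} λ k<n → none k<n) e p^e∣)
               (≤-reflexive (trans (cong (n *_) (trans (∑-const n 0) (*-zeroʳ n))) (*-zeroʳ n))))
      where
      none : ∀ {k} → k < n → Val≤ p (k²+1 (suc k)) 0
      none k<n zero    _ = z≤n
      none k<n (suc e) d = contradiction (smooth pp k<n (m*n∣⇒m∣ p (p ^ e) d)) p≰2n

  E>0 : 0 < E
  E>0 = *-mono-< {0} {_} {0} (m^n>0 2 n) (*-mono-< {0} {_} {0} (m^n>0 _ {{>-nonZero (#>0 (n + n))}} 6) (m^n>0 _ {{>-nonZero (#>0 T)}} (4 * L)))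

  P≤ : P ≤ (8 * n) ^ n * E
  P≤ = ^-cancelˡ-≤ n (begin
    P ^ n                     ≤⟨ ∣⇒≤ {{>-nonZero (*-mono-< {0} {_} {0} G>0 (m^n>0 E {{>-nonZero E>0}} n))}} P^n∣ ⟩
    G * E ^ n                 ≤⟨ *-monoˡ-≤ (E ^ n) G≤ ⟩
    ((8 * n) ^ n) ^ n * E ^ n ≡⟨ sym (^-distribʳ-* ((8 * n) ^ n) E n) ⟩
    ((8 * n) ^ n * E) ^ n     ∎)
    where open ≤-Reasoning

  -- The primorial of 2n to the sixth power gives 4^(12n). The small-prime factor is at most 4^(4TL)
  -- = 2^(128 (h+1) 2^h), so the hypothesis brings it below 2^n. `4 ^ 12` enters as a variable `c`
  -- and stays opaque in the calculations.
  E≤ : 128 * suc h ≤ 2 ^ h → ∀ {c} → 4 ^ 12 ≡ c → E ≤ (4 * c) ^ n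
  E≤ 128[1+h]≤2^h {c} 4^12≡c = begin
    2 ^ n * (((n + n) #) ^ 6 * (T #) ^ (4 * L))
      ≤⟨ *-monoʳ-≤ (2 ^ n) (*-mono-≤ (^-monoˡ-≤ 6 (#≤4^ (n + n))) small) ⟩
    2 ^ n * ((4 ^ (n + n)) ^ 6 * 2 ^ n)
      ≡⟨ cong (λ z → 2 ^ n * (z * 2 ^ n)) sixth ⟩
    2 ^ n * (c ^ n * 2 ^ n)
      ≡⟨ eq₂ (2 ^ n) (c ^ n) ⟩
    2 ^ n * 2 ^ n * c ^ n
      ≡⟨ cong (_* c ^ n) (sym (^-distribʳ-* 2 2 n)) ⟩
    4 ^ n * c ^ n
      ≡⟨ sym (^-distribʳ-* 4 c n) ⟩
    (4 * c) ^ n ∎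
    where
    open ≤-Reasoning
    eq₁ : ∀ n → (n + n) * 6 ≡ 12 * n
    eq₁ = solve-∀
    eq₂ : ∀ a b → a * (b * a) ≡ a * a * b
    eq₂ = solve-∀
    sixth : (4 ^ (n + n)) ^ 6 ≡ c ^ n
    sixth = trans (^-*-assoc 4 (n + n) 6) (trans (cong (4 ^_) (eq₁ n))
      (trans (sym (^-*-assoc 4 12 n)) (cong (_^ n) 4^12≡c)))
    eq₃ : ∀ a s → 2 * (2 * (2 * a) * (4 * (4 * s))) ≡ a * (128 * s)
    eq₃ = solve-∀
    small : (T #) ^ (4 * L) ≤ 2 ^ n
    small = begin
      (T #) ^ (4 * L)     ≤⟨ ^-monoˡ-≤ (4 * L) (#≤4^ T) ⟩
      (4 ^ T) ^ (4 * L)   ≡⟨ ^-*-assoc 4 T (4 * L) ⟩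
      4 ^ (T * (4 * L))   ≡⟨ ^-*-assoc 2 2 (T * (4 * L)) ⟩
      2 ^ (2 * (T * (4 * L))) ≤⟨ ^-monoʳ-≤ 2 (begin
        2 * (T * (4 * L))   ≡⟨ eq₃ (2 ^ h) (suc h) ⟩
        2 ^ h * (128 * suc h) ≤⟨ *-monoʳ-≤ (2 ^ h) 128[1+h]≤2^h ⟩
        2 ^ h * 2 ^ h       ≡⟨ sym (^-distribʳ-* 2 2 h) ⟩
        4 ^ h               ≤⟨ 4^h≤n ⟩
        n                   ∎) ⟩
      2 ^ n ∎

  -- `n^n≤4^n*n!`, squared, gives n^(2n) ≤ 16^n (n!)² ≤ 16^n P; then n-th roots are taken and one
  -- factor `n` is cancelled.
  n≤16K : ∀ K → P ≤ (K * n) ^ n → n ≤ 16 * K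
  n≤16K K P≤ = *-cancelʳ-≤ n (16 * K) n (^-cancelˡ-≤ n (begin
    (n * n) ^ n                       ≡⟨ ^-distribʳ-* n n n ⟩
    n ^ n * n ^ n                     ≤⟨ *-mono-≤ (n^n≤4^n*n! n) (n^n≤4^n*n! n) ⟩
    4 ^ n * n ! * (4 ^ n * n !)       ≡⟨ shuffle (4 ^ n) (n !) ⟩
    4 ^ n * 4 ^ n * (n ! * n !)       ≤⟨ *-monoʳ-≤ (4 ^ n * 4 ^ n) (≤-trans (n!²≤∏ n) P≤) ⟩
    4 ^ n * 4 ^ n * (K * n) ^ n       ≡⟨ cong (_* (K * n) ^ n) (sym (^-distribʳ-* 4 4 n)) ⟩
    16 ^ n * (K * n) ^ n              ≡⟨ sym (^-distribʳ-* 16 (K * n) n) ⟩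
    (16 * (K * n)) ^ n                ≡⟨ cong (_^ n) (sym (*-assoc 16 K n)) ⟩
    (16 * K * n) ^ n                  ∎))
    where
    open ≤-Reasoning
    shuffle : ∀ a b → a * b * (a * b) ≡ a * a * (b * b)
    shuffle = solve-∀

  n-bounded : 128 * suc h ≤ 2 ^ h → ∀ {c} → 4 ^ 12 ≡ c → n ≤ 16 * (4 * c * 8)
  n-bounded 128[1+h]≤2^h {c} 4^12≡c = n≤16K (4 * c * 8) (begin
    P                         ≤⟨ P≤ ⟩
    (8 * n) ^ n * E           ≤⟨ *-monoʳ-≤ ((8 * n) ^ n) (E≤ 128[1+h]≤2^h 4^12≡c) ⟩
    (8 * n) ^ n * (4 * c) ^ n ≡⟨ sym (^-distribʳ-* (8 * n) (4 * c) n) ⟩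
    (8 * n * (4 * c)) ^ n     ≡⟨ cong (_^ n) (eq n c) ⟩
    (4 * c * 8 * n) ^ n       ∎)
    where
    open ≤-Reasoning
    eq : ∀ n c → 8 * n * (4 * c) ≡ 4 * c * 8 * n
    eq = solve-∀

-- A prime factor above 2n for all n ≥ 4^17

bracket : ∀ b k {n} → 4 ^ b ≤ n → n < 4 ^ (b + k) → ∃ λ h → b ≤ h × 4 ^ h ≤ n × n < 4 ^ suc h
bracket b zero    lo hi = contradiction (subst (λ b → _ < 4 ^ b) (+-identityʳ b) hi) (≤⇒≯ lo)
bracket b (suc k) {n} lo hi with n <? 4 ^ (b + k)
... | yes n< = bracket b k lo n<
... | no n≮  = b + k , m≤m+n b k , ≮⇒≥ n≮ , subst (λ e → n < 4 ^ e) (+-suc b k) hi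

n<4^n : ∀ n → n < 4 ^ n
n<4^n zero    = s≤s z≤n
n<4^n (suc n) = ≤-trans (s≤s (n<4^n n)) (+-mono-≤ (m^n>0 4 n) (m≤m+n (4 ^ n) _))

linear≤2^ : ∀ h o → 128 * suc h ≤ 2 ^ h → 128 * suc (h + o) ≤ 2 ^ (h + o)
linear≤2^ h zero    b = subst (λ h → 128 * suc h ≤ 2 ^ h) (sym (+-identityʳ h)) b
linear≤2^ h (suc o) b = subst (λ h → 128 * suc h ≤ 2 ^ h) (sym (+-suc h o)) (begin
  128 * suc (suc (h + o))   ≤⟨ *-monoʳ-≤ 128 (s≤s (m≤n+m _ (h + o))) ⟩
  128 * (suc (h + o) + suc (h + o)) ≡⟨ eq (suc (h + o)) ⟩
  2 * (128 * suc (h + o))   ≤⟨ *-monoʳ-≤ 2 (linear≤2^ h o b) ⟩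
  2 ^ suc (h + o)           ∎)
  where
  open ≤-Reasoning
  eq : ∀ a → 128 * (a + a) ≡ 2 * (128 * a)
  eq = solve-∀

not-smooth : ∀ b {c} → 4 ^ 12 ≡ c → 16 * (4 * c * 8) < 4 ^ b → 128 * suc b ≤ 2 ^ b → ∀ n → 4 ^ b ≤ n →
  ¬ (∀ {p} → Prime p → ∀ {k} → k < n → p ∣ k²+1 (suc k) → p ≤ n + n)
not-smooth b {c} 4^12≡c c<4^b linear n 4^b≤n smooth
  with bracket b n 4^b≤n (<-≤-trans (n<4^n n) (^-monoʳ-≤ 4 (m≤n+m n b)))
... | h , b≤h , lo , hi with m≤n⇒∃[o]m+o≡n b≤h
... | o , refl = <⇒≱ (<-≤-trans c<4^b 4^b≤n)
  (Smooth.n-bounded n (b + o) lo hi smooth (linear≤2^ b o linear) 4^12≡c)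

-- The bound of `n-bounded` is 16 · 4 · 4^12 · 8 = 2^33, just below 4^17 = 2^34.
not-smooth-17 : ∀ n → 4 ^ 17 ≤ n →
  ¬ (∀ {p} → Prime p → ∀ {k} → k < n → p ∣ k²+1 (suc k) → p ≤ n + n)
not-smooth-17 = not-smooth 17 {4 ^ 12} refl (<ᵇ⇒< (16 * (4 * 4 ^ 12 * 8)) (4 ^ 17) _) (≤ᵇ⇒≤ (128 * 18) (2 ^ 17) _)

-- Numerators and denominators of reciprocal sums

-- num D n / den D n is the unreduced fraction for 1/D 1 + ⋯ + 1/D n.
den num : (ℕ → ℕ) → ℕ → ℕ
den D zero    = 1
den D (suc n) = den D n * D (suc n)
num D zero    = 0
num D (suc n) = num D n * D (suc n) + den D n

recip-≃ : ∀ d .{{_ : NonZero d}} → toℚᵘ (recip d) ≃ (+ 1 /ᵘ d)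
recip-≃ (suc d) = ℚₚ.toℚᵘ-fromℚᵘ (mkℚᵘ (+ 1) d)

/ᵘ-+ : ∀ a b c .{{_ : NonZero b}} .{{_ : NonZero c}} .{{_ : NonZero (b * c)}} →
       (+ a /ᵘ b) +ᵘ (+ 1 /ᵘ c) ≃ (+ (a * c + b) /ᵘ (b * c))
/ᵘ-+ a (suc b) (suc c) = *≡* (cong (ℤ._* + (suc b * suc c)) (begin
  + a ℤ.* + suc c ℤ.+ + 1 ℤ.* + suc b  ≡⟨ cong₂ ℤ._+_ (sym (ℤₚ.pos-* a (suc c))) (ℤₚ.*-identityˡ (+ suc b)) ⟩
  + (a * suc c) ℤ.+ + suc b            ≡⟨ sym (ℤₚ.pos-+ (a * suc c) (suc b)) ⟩
  + (a * suc c + suc b)                ∎))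
  where open ≡-Reasoning

module _ (f : Poly) (s : ℕ → ℕ) where

  term : ℕ → ℕ
  term k = eval f k ^ s k

  module _ (term≢0 : ∀ k → NonZero (term (suc k))) where

    den≢0 : ∀ n → NonZero (den term n)
    den≢0 zero    = _
    den≢0 (suc n) = m*n≢0 (den term n) (term (suc n)) {{den≢0 n}} {{term≢0 n}}

    H≃num/den : ∀ n → toℚᵘ (H f s n) ≃ ((+ num term n) /ᵘ den term n) {{den≢0 n}}
    H≃num/den zero    = *≡* refl
    H≃num/den (suc n) = ℚᵘₚ.≃-trans (ℚₚ.toℚᵘ-homo-+ (H f s n) (recip (term (suc n))))
      (ℚᵘₚ.≃-trans (ℚᵘₚ.+-cong (H≃num/den n) (recip-≃ (term (suc n)) {{term≢0 n}}))
        (/ᵘ-+ (num term n) (den term n) (term (suc n)) {{den≢0 n}} {{term≢0 n}} {{den≢0 (suc n)}}))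

    -- Cross-multiplication with z/1 moves the question from ℚ to divisibility in ℕ.
    integral⇒den∣num : ∀ n z → H f s n ≡ z / 1 → den term n ∣ num term n
    integral⇒den∣num n z eq = cross (den term n) {{den≢0 n}} (ℚᵘₚ.≃-trans (ℚᵘₚ.≃-sym (H≃num/den n))
      (ℚᵘₚ.≃-trans (ℚᵘₚ.≃-reflexive (cong toℚᵘ eq)) (ℚₚ.toℚᵘ-fromℚᵘ (mkℚᵘ z 0))))
      where
      cross : ∀ d .{{_ : NonZero d}} {a} → (+ a /ᵘ d) ≃ mkℚᵘ z 0 → d ∣ a
      cross (suc d) {a} (*≡* e) = divides ∣ z ∣ (begin
        a                     ≡⟨ cong ∣_∣ (sym (ℤₚ.*-identityʳ (+ a))) ⟩
        ∣ + a ℤ.* + 1 ∣       ≡⟨ cong ∣_∣ e ⟩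
        ∣ z ℤ.* + suc d ∣     ≡⟨ ℤₚ.abs-* z (+ suc d) ⟩
        ∣ z ∣ * suc d         ∎)
        where open ≡-Reasoning

module _ (D : ℕ → ℕ) (D>0 : ∀ k → 0 < D (suc k)) where

  den>0 : ∀ n → 0 < den D n
  den>0 zero    = ≤-refl
  den>0 (suc n) = *-mono-< {0} {_} {0} (den>0 n) (D>0 n)

  num>0 : ∀ n → 0 < num D (suc n)
  num>0 n = ≤-trans (den>0 n) (m≤n+m _ _)

  proper⇒¬∣ : ∀ n → num D (suc n) < den D (suc n) → ¬ den D (suc n) ∣ num D (suc n)
  proper⇒¬∣ n num<den = >⇒∤ {{>-nonZero (num>0 n)}} num<den

  -- The bound num/den ≤ B − 1/(n + c) is preserved because 1/(m (m + 1)) = 1/m − 1/(m + 1).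
  telescope : ∀ B c n₀ → 0 < n₀ + c →
    num D n₀ * (n₀ + c) + den D n₀ ≤ B * (den D n₀ * (n₀ + c)) →
    (∀ o → (n₀ + o + c) * suc (n₀ + o + c) ≤ D (suc (n₀ + o))) →
    ∀ o → num D (n₀ + o) * (n₀ + o + c) + den D (n₀ + o) ≤ B * (den D (n₀ + o) * (n₀ + o + c))
  telescope B c n₀ pos base big zero rewrite +-identityʳ n₀ = base
  telescope B c n₀ pos base big (suc o) rewrite +-suc n₀ o =
    step (num D n) (den D n) (n + c) (D (suc n)) {{>-nonZero (≤-trans pos (+-monoˡ-≤ c (m≤m+n n₀ o)))}}
      (telescope B c n₀ pos base big o) (big o)
    where
    n = n₀ + o
    step : ∀ a b m d .{{_ : NonZero m}} → a * m + b ≤ B * (b * m) → m * suc m ≤ d →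
      (a * d + b) * suc m + b * d ≤ B * (b * d * suc m)
    step a b m d ih m²≤d = *-cancelˡ-≤ m (begin
      m * ((a * d + b) * suc m + b * d)            ≡⟨ eq₁ a b m d ⟩
      a * m * (d * suc m) + b * d * m + b * (m * suc m) ≤⟨ +-monoʳ-≤ (a * m * (d * suc m) + b * d * m) (*-monoʳ-≤ b m²≤d) ⟩
      a * m * (d * suc m) + b * d * m + b * d      ≡⟨ eq₂ a b m d ⟩
      (a * m + b) * (d * suc m)                    ≤⟨ *-monoˡ-≤ (d * suc m) ih ⟩
      B * (b * m) * (d * suc m)                    ≡⟨ eq₃ B b m d ⟩
      m * (B * (b * d * suc m))                    ∎)
      where
      open ≤-Reasoning
      eq₁ : ∀ a b m d → m * ((a * d + b) * suc m + b * d) ≡ a * m * (d * suc m) + b * d * m + b * (m * suc m)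
      eq₁ = solve-∀
      eq₂ : ∀ a b m d → a * m * (d * suc m) + b * d * m + b * d ≡ (a * m + b) * (d * suc m)
      eq₂ = solve-∀
      eq₃ : ∀ B b m d → B * (b * m) * (d * suc m) ≡ m * (B * (b * d * suc m))
      eq₃ = solve-∀

  telescoped< : ∀ B m n → 0 < m → num D n * m + den D n ≤ B * (den D n * m) → num D n < B * den D n
  telescoped< B m n m>0 h = *-cancelʳ-< m _ _ (begin-strict
    num D n * m           <⟨ m<m+n _ (den>0 n) ⟩
    num D n * m + den D n ≤⟨ h ⟩
    B * (den D n * m)     ≡⟨ sym (*-assoc B (den D n) m) ⟩
    B * den D n * m       ∎)
    where open ≤-Reasoning

  den≤num : D 1 ≡ 1 → ∀ n → den D (suc n) ≤ num D (suc n)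
  den≤num D1≡1 zero    rewrite D1≡1 = ≤-refl
  den≤num D1≡1 (suc n) = ≤-trans (*-monoˡ-≤ (D (suc (suc n))) (den≤num D1≡1 n)) (m≤m+n _ _)

  between-1-and-2⇒¬∣ : ∀ n → den D n < num D n → num D n < 2 * den D n → ¬ den D n ∣ num D n
  between-1-and-2⇒¬∣ n lo hi (divides q eq) = <⇒≱ (≤-<-trans 2≤q q<2) ≤-refl
    where
    2≤q : 2 ≤ q
    2≤q = *-cancelʳ-< (den D n) 1 q (subst₂ _<_ (sym (+-identityʳ _)) eq lo)
    q<2 : q < 2
    q<2 = *-cancelʳ-< (den D n) q 2 (subst (_< 2 * den D n) eq hi)

  -- Before the term at `i`, `p` does not divide the denominator. That term makes the new
  -- denominator divisible by `p` and adds the old one to a multiple of `p` in the numerator. Later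
  -- terms multiply the numerator by numbers prime to `p` and add multiples of `p`.
  isolated⇒¬∣ : ∀ {p} → Prime p → ∀ n i → i < n → p ∣ D (suc i) →
    (∀ {j} → j < n → j ≢ i → p ∤ D (suc j)) → ¬ den D n ∣ num D n
  isolated⇒¬∣ {p} pp n i i<n p∣Di others d∣n = let p∣den , p∤num = after n ≤-refl i<n in p∤num (∣-trans p∣den d∣n)
    where
    before : ∀ m → m ≤ i → p ∤ den D m
    before zero    _   p∣1 = contradiction (subst Prime (∣1⇒≡1 p∣1) pp) ¬prime[1]
    before (suc m) m<i p∣  with euclidsLemma (den D m) (D (suc m)) pp p∣
    ... | inj₁ h = before m (<⇒≤ m<i) h
    ... | inj₂ h = others (<-trans m<i i<n) (<⇒≢ m<i) h
    after : ∀ m → m ≤ n → i < m → p ∣ den D m × p ∤ num D m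
    after (suc m) m<n (s≤s i≤m) with m ≟ i
    ... | yes refl = ∣n⇒∣m*n (den D m) p∣Di , λ h → before m ≤-refl (∣m+n∣m⇒∣n h (∣n⇒∣m*n (num D m) p∣Di))
    ... | no m≢i with after m (<⇒≤ m<n) (≤∧≢⇒< i≤m (m≢i ∘ sym))
    ... | p∣den , p∤num = ∣m⇒∣m*n (D (suc m)) p∣den , λ h →
      [ p∤num , others m<n m≢i ]′ (euclidsLemma (num D m) (D (suc m)) pp
        (∣m+n∣m⇒∣n (subst (p ∣_) (+-comm _ (den D m)) h) p∣den))

-- The polynomial x² + 1

-- `p` divides b² - a² = (b - a)(b + a), and neither factor exceeds b + a.
k²+1-distinct : ∀ {p a b} → Prime p → a < b → p ∣ k²+1 a → p ∣ k²+1 b → p ≤ b + a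
k²+1-distinct {p} {a} pp a<b p∣a p∣b with m≤n⇒∃[o]m+o≡n a<b
... | o , refl with euclidsLemma (suc o) (b + a) pp (∣m+n∣m⇒∣n (subst (p ∣_) (eq a o) p∣b) p∣a)
  where
  b = suc a + o
  eq : ∀ a o → suc (suc (a + o) * suc (a + o)) ≡ suc (a * a) + suc o * (suc (a + o) + a)
  eq = solve-∀
... | inj₁ h = ≤-trans (∣⇒≤ h) (≤-trans (s≤s (m≤n+m o a)) (m≤m+n _ a))
... | inj₂ h = ∣⇒≤ h

-- The divisors tested are 2, …, d + 1.
noDivisor : ℕ → ℕ → Bool
noDivisor p zero    = true
noDivisor p (suc d) = not (p % suc (suc d) ≡ᵇ 0) ∧ noDivisor p d

noDivisor⇒rough : ∀ p d → Bool.T (noDivisor p d) → suc (suc d) Rough p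
noDivisor⇒rough p zero    _ = 2-rough
noDivisor⇒rough p (suc d) t with p % suc (suc d) in eq
... | suc _ = ∤⇒rough-suc (λ d∣p → contradiction (trans (sym eq) (n∣m⇒m%n≡0 p (suc (suc d)) d∣p)) λ ()) (noDivisor⇒rough p d t)

-- Trial division up to k + 1 suffices, as (k + 1)² + 1 < (k + 2)².
k²+1-prime : ∀ k → Bool.T (noDivisor (k²+1 (suc k)) k) → Prime (k²+1 (suc k))
k²+1-prime k t = rough∧square>⇒prime {m = suc (suc k)} (noDivisor⇒rough (k²+1 (suc k)) k t)
  (≤-trans (m≤m+n _ (suc (2 * k))) (≤-reflexive (eq k)))
  where
  eq : ∀ k → suc (suc (suc k * suc k)) + suc (2 * k) ≡ suc (suc k) * suc (suc k)
  eq = solve-∀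

powers : (ℕ → ℕ) → ℕ → ℕ
powers s k = k²+1 k ^ s k

powers>0 : ∀ s k → 0 < powers s (suc k)
powers>0 s k = m^n>0 (k²+1 (suc k)) (s (suc k))

module _ (s : ℕ → ℕ) (s≥1 : ∀ k → 1 ≤ s (suc k)) (n : ℕ) where

  -- A second index up to `n` whose term is divisible by `p` would force p ≤ n + (k + 1) by
  -- `k²+1-distinct`, so `p` is isolated.
  large-prime⇒¬∣ : ∀ {p} → Prime p → ∀ {k} → k < n → p ∣ k²+1 (suc k) → n + suc k < p →
    ¬ den (powers s) n ∣ num (powers s) n
  large-prime⇒¬∣ {p} pp {k} k<n p∣ n+k<p = isolated⇒¬∣ (powers s) (powers>0 s) pp n k k<n
    (∣-trans (∣-trans p∣ (∣-reflexive (sym (^-identityʳ _)))) (^-monoʳ-∣ (k²+1 (suc k)) (s≥1 k)))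
    λ {j} j<n j≢k p∣Dj → other j<n j≢k (prime∣^⇒∣ pp (k²+1 (suc j)) (s (suc j)) p∣Dj)
    where
    other : ∀ {j} → j < n → j ≢ k → p ∤ k²+1 (suc j)
    other {j} j<n j≢k p∣j with <-cmp j k
    ... | tri< j<k _ _ = <⇒≱ n+k<p (≤-trans (k²+1-distinct pp (s≤s j<k) p∣j p∣)
          (≤-trans (≤-reflexive (+-comm (suc k) (suc j))) (+-monoˡ-≤ (suc k) j<n)))
    ... | tri≈ _ j≡k _ = j≢k j≡k
    ... | tri> _ _ k<j = <⇒≱ n+k<p (≤-trans (k²+1-distinct pp (s≤s k<j) p∣ p∣j) (+-monoˡ-≤ (suc k) j<n))

  large-n⇒¬∣ : 4 ^ 17 ≤ n → ¬ den (powers s) n ∣ num (powers s) n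
  large-n⇒¬∣ 4^17≤n d∣n = not-smooth-17 n 4^17≤n λ pp k<n p∣ →
    ≮⇒≥ λ 2n<p → large-prime⇒¬∣ pp k<n p∣ (≤-<-trans (+-monoʳ-≤ n k<n) 2n<p) d∣n

  -- A prime k² + 1 settles all n with k ≤ n < k² + 1 - k.
  covered : ∀ k {m} → Bool.T (noDivisor (k²+1 (suc k)) k) → m + suc k ≤ k²+1 (suc k) →
    (m ≤ n → ¬ den (powers s) n ∣ num (powers s) n) → suc k ≤ n → ¬ den (powers s) n ∣ num (powers s) n
  covered k {m} t m+k≤p next k<n with n + suc k <? k²+1 (suc k)
  ... | yes n+k<p = large-prime⇒¬∣ (k²+1-prime k t) k<n ∣-refl n+k<p
  ... | no  n+k≮p = next (+-cancelʳ-≤ (suc k) m n (≤-trans m+k≤p (≮⇒≥ n+k≮p)))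

  n≥4⇒¬∣ : 4 ≤ n → ¬ den (powers s) n ∣ num (powers s) n
  n≥4⇒¬∣ =
    -- The primes are k² + 1 for k = 4, 10, 90, 7956, 133070 (the argument is k - 1). The implicit
    -- argument is the start of the next range; 133070 exceeds 2^17, so the last range reaches 4^17.
    covered 3      {10}         _ (≤ᵇ⇒≤ 14          (k²+1 4)      _) (
    covered 9      {90}         _ (≤ᵇ⇒≤ 100         (k²+1 10)     _) (
    covered 89     {7956}       _ (≤ᵇ⇒≤ 8046        (k²+1 90)     _) (
    covered 7955   {133070}     _ (≤ᵇ⇒≤ 141026      (k²+1 7956)   _) (
    covered 133069 {4 ^ 17}     _ (≤ᵇ⇒≤ 17180002254 (k²+1 133070) _)
    large-n⇒¬∣))))

-- Growth of polynomials of degree at least two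

-- A coefficient list may end in zeros, so its length does not show whether the polynomial vanishes;
-- with nonnegative coefficients one nonzero entry makes every value at k ≥ 1 positive.
eval-zero⊎pos : ∀ q → (∀ k → eval q k ≡ 0) ⊎ (∀ k → 1 ≤ eval q (suc k))
eval-zero⊎pos []          = inj₁ λ _ → refl
eval-zero⊎pos (suc a ∷ q) = inj₂ λ _ → s≤s z≤n
eval-zero⊎pos (zero ∷ q) with eval-zero⊎pos q
... | inj₁ z = inj₁ λ k → trans (cong (k *_) (z k)) (*-zeroʳ k)
... | inj₂ h = inj₂ λ k → *-mono-≤ {1} {suc k} {1} (s≤s z≤n) (h k)

degree≥2-split : ∀ {f} → DegreeAtLeast2 f →
  ∃₂ λ a b → ∃ λ q → f ≡ a ∷ b ∷ q × (∀ k → 1 ≤ eval q (suc k))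
degree≥2-split (here {a₀} {a₁} {m} rest) = a₀ , a₁ , suc m ∷ rest , refl , λ _ → s≤s z≤n
degree≥2-split (there {a₀} d) with degree≥2-split d
... | a , b , q , refl , h = a₀ , a , b ∷ q , refl ,
  λ k → ≤-trans (*-mono-≤ {1} {suc k} {1} (s≤s z≤n) (h k)) (m≤n+m _ b)

k²≤eval : ∀ {f} → DegreeAtLeast2 f → ∀ k → suc k * suc k ≤ eval f (suc k)
k²≤eval d k with degree≥2-split d
... | a , b , q , refl , h = begin
  suc k * suc k                             ≡⟨ cong (suc k *_) (sym (*-identityʳ (suc k))) ⟩
  suc k * (suc k * 1)                       ≤⟨ *-monoʳ-≤ (suc k) (*-monoʳ-≤ (suc k) (h k)) ⟩
  suc k * (suc k * eval q (suc k))          ≤⟨ *-monoʳ-≤ (suc k) (m≤n+m _ b) ⟩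
  suc k * (b + suc k * eval q (suc k))      ≤⟨ m≤n+m _ a ⟩
  a + suc k * (b + suc k * eval q (suc k))  ∎
  where open ≤-Reasoning

-- A linear term gives x² + x, a term of degree at least 3 gives x³ ≥ x(x + 1) for x ≥ 2 (x = 1 is
-- the hypothesis on `eval f 1`), and a quadratic coefficient of at least 2 gives 2x². Only x² + c
-- remains.
k[k+1]≤eval⊎k²+c : ∀ {f} → DegreeAtLeast2 f → 2 ≤ eval f 1 →
  (∀ k → suc k * suc (suc k) ≤ eval f (suc k)) ⊎ ∃ λ c → ∀ k → eval f k ≡ k * k + c
k[k+1]≤eval⊎k²+c d f1≥2 with degree≥2-split d
... | a , b , []    , refl , h = contradiction (h 0) λ ()
... | a , suc b , q , refl , h = inj₁ λ k → let x = suc k in begin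
  x * suc x                       ≤⟨ *-monoʳ-≤ x (s≤s (≤-trans (≤-reflexive (sym (*-identityʳ x))) (*-monoʳ-≤ x (h k)))) ⟩
  x * suc (x * eval q x)          ≤⟨ *-monoʳ-≤ x (s≤s (m≤n+m _ b)) ⟩
  x * (suc b + x * eval q x)      ≤⟨ m≤n+m _ a ⟩
  a + x * (suc b + x * eval q x)  ∎
  where open ≤-Reasoning
... | a , zero , e ∷ r , refl , h with eval-zero⊎pos r
... | inj₂ r>0 = inj₁ bound
  where
  open ≤-Reasoning
  bound : ∀ k → suc k * suc (suc k) ≤ eval (a ∷ zero ∷ e ∷ r) (suc k)
  bound zero    = f1≥2
  bound (suc k) = let x = suc (suc k) in begin
    x * suc x                          ≤⟨ *-monoʳ-≤ x (≤-trans (≤-trans (s≤s (m≤n+m x k)) (≤-reflexive (+-comm (suc k) x))) (m≤m+n (x + suc k) (suc k * x ∸ suc k))) ⟩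
    x * (x + suc k + (suc k * x ∸ suc k)) ≡⟨ cong (x *_) (trans (+-assoc x (suc k) _) (cong (λ z → x + z) (m+[n∸m]≡n (m≤m*n (suc k) x)))) ⟩
    x * (x * x)                        ≤⟨ *-monoʳ-≤ x (*-monoʳ-≤ x (≤-trans (≤-trans (≤-reflexive (sym (*-identityʳ x))) (*-monoʳ-≤ x (r>0 (suc k)))) (m≤n+m _ e))) ⟩
    x * (x * (e + x * eval r x))       ≤⟨ m≤n+m _ a ⟩
    a + x * (x * (e + x * eval r x))   ∎
... | inj₁ r≡0 = by-leading e (λ k → trans (cong (λ z → e + k * z) (r≡0 k)) (trans (cong (λ z → e + z) (*-zeroʳ k)) (+-identityʳ e))) (h 0)
  where
  by-leading : ∀ e′ → (∀ k → eval (e ∷ r) k ≡ e′) → 1 ≤ eval (e ∷ r) 1 →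
    (∀ k → suc k * suc (suc k) ≤ eval (a ∷ zero ∷ e ∷ r) (suc k)) ⊎
    ∃ λ c → ∀ k → eval (a ∷ zero ∷ e ∷ r) k ≡ k * k + c
  by-leading zero          lead pos = contradiction (subst (1 ≤_) (lead 1) pos) λ ()
  by-leading (suc zero)    lead _   = inj₂ (a , λ k →
    trans (cong (λ z → a + k * (k * z)) (lead k)) (trans (cong (λ z → a + k * z) (*-identityʳ k)) (+-comm a (k * k))))
  by-leading (suc (suc e′)) lead _  = inj₁ λ k → let x = suc k in begin
    x * suc x                     ≤⟨ *-monoʳ-≤ x (≤-trans (≤-reflexive (+-comm 1 x)) (+-monoʳ-≤ x (s≤s z≤n))) ⟩
    x * (x + x)                   ≡⟨ cong (x *_) (trans (cong (λ z → x + z) (sym (+-identityʳ x))) (*-comm 2 x)) ⟩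
    x * (x * 2)                   ≤⟨ *-monoʳ-≤ x (*-monoʳ-≤ x (s≤s (s≤s z≤n))) ⟩
    x * (x * suc (suc e′))        ≡⟨ cong (λ z → x * (x * z)) (sym (lead x)) ⟩
    x * (x * eval (e ∷ r) x)      ≤⟨ m≤n+m _ a ⟩
    a + x * (x * eval (e ∷ r) x)  ∎
    where open ≤-Reasoning

-- Non-integrality by size, for each type of growth

module _ (D : ℕ → ℕ) (D>0 : ∀ k → 0 < D (suc k)) where

  -- The first term is 1 and the others are at most 1/k² ≤ 1/((k - 1)k), which telescopes from k = 2
  -- to less than 1.
  D1≡1⇒¬∣ : D 1 ≡ 1 → (∀ k → suc k * suc k ≤ D (suc k)) → ∀ n → ¬ den D (2 + n) ∣ num D (2 + n)
  D1≡1⇒¬∣ D1≡1 D≥ n = between-1-and-2⇒¬∣ D D>0 (2 + n)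
    (≤-<-trans (*-monoˡ-≤ (D (2 + n)) (den≤num D D>0 D1≡1 n)) (m<m+n _ (den>0 D D>0 (suc n))))
    (telescoped< D D>0 2 (2 + n + 0) (2 + n) (s≤s z≤n)
      (telescope D D>0 2 0 1 (s≤s z≤n) base growth (suc n)))
    where
    base : num D 1 * 1 + den D 1 ≤ 2 * (den D 1 * 1)
    base rewrite D1≡1 = ≤-refl
    growth : ∀ o → suc (o + 0) * suc (suc (o + 0)) ≤ D (suc (suc o))
    growth o rewrite +-identityʳ o = ≤-trans (*-monoˡ-≤ (suc (suc o)) (n≤1+n (suc o))) (D≥ (suc o))

  -- The terms 1/(k(k + 1)) sum to 1 - 1/(n + 1); this is `telescope` from the empty sum with shift
  -- 1.
  k[k+1]≤D⇒¬∣ : (∀ k → suc k * suc (suc k) ≤ D (suc k)) → ∀ n → ¬ den D (suc n) ∣ num D (suc n)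
  k[k+1]≤D⇒¬∣ D≥ n = proper⇒¬∣ D D>0 n (subst (num D (suc n) <_) (*-identityˡ _)
    (telescoped< D D>0 1 (suc n + 1) (suc n) (s≤s z≤n)
      (telescope D D>0 1 1 0 (s≤s z≤n) ≤-refl
        (λ o → subst (λ m → m * suc m ≤ D (suc o)) (+-comm 1 o) (D≥ o)) (suc n))))

  -- The first two terms give at most 1/3 + 1/6 = 1 - 1/2, exactly the bound from which `telescope`
  -- can start at `n₀ = 2` with shift 0.
  k²+2≤D⇒¬∣ : (∀ k → suc k * suc k + 2 ≤ D (suc k)) → ∀ n → ¬ den D (2 + n) ∣ num D (2 + n)
  k²+2≤D⇒¬∣ D≥ n = proper⇒¬∣ D D>0 (suc n) (subst (num D (2 + n) <_) (*-identityˡ _)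
    (telescoped< D D>0 1 (2 + n + 0) (2 + n) (s≤s z≤n)
      (telescope D D>0 1 0 2 (s≤s z≤n) (base (D≥ 0) (D≥ 1)) growth n)))
    where
    base : ∀ {a b} → 3 ≤ a → 6 ≤ b → (1 * b + 1 * a) * 2 + 1 * a * b ≤ 1 * (1 * a * b * 2)
    base 3≤a 6≤b with m≤n⇒∃[o]m+o≡n 3≤a | m≤n⇒∃[o]m+o≡n 6≤b
    -- With a = 3 + u and b = 6 + v, the two sides differ by the polynomial 4u + v + uv, whose
    -- coefficients are nonnegative.
    ... | u , refl | v , refl = ≤-trans (m≤m+n _ (u * 4 + v + u * v)) (≤-reflexive (eq u v))
      where
      eq : ∀ u v → (1 * (6 + v) + 1 * (3 + u)) * 2 + 1 * (3 + u) * (6 + v) + (u * 4 + v + u * v) ≡ 1 * (1 * (3 + u) * (6 + v) * 2)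
      eq = solve-∀
    growth : ∀ o → (2 + o + 0) * suc (2 + o + 0) ≤ D (suc (2 + o))
    growth o rewrite +-identityʳ o =
      ≤-trans (*-monoˡ-≤ (3 + o) (n≤1+n (2 + o))) (≤-trans (m≤m+n _ 2) (D≥ (2 + o)))

  -- Here 1/2 + 1/5 < 1, and in `three-terms⇒¬∣` 1/2 + 1/5 + 1/10 < 1; they settle n = 2 and n = 3
  -- for x² + 1, before the range of the first explicit prime.
  two-terms⇒¬∣ : 2 ≤ D 1 → 5 ≤ D 2 → ¬ den D 2 ∣ num D 2
  two-terms⇒¬∣ 2≤D1 5≤D2 = proper⇒¬∣ D D>0 1 (bound 2≤D1 5≤D2)
    where
    bound : ∀ {a b} → 2 ≤ a → 5 ≤ b → 1 * b + 1 * a < 1 * a * b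
    bound 2≤a 5≤b with m≤n⇒∃[o]m+o≡n 2≤a | m≤n⇒∃[o]m+o≡n 5≤b
    ... | u , refl | v , refl = ≤-trans (m≤m+n _ (2 + u * 4 + v + u * v)) (≤-reflexive (eq u v))
      where
      eq : ∀ u v → suc (1 * (5 + v) + 1 * (2 + u)) + (2 + u * 4 + v + u * v) ≡ 1 * (2 + u) * (5 + v)
      eq = solve-∀

  three-terms⇒¬∣ : 2 ≤ D 1 → 5 ≤ D 2 → 10 ≤ D 3 → ¬ den D 3 ∣ num D 3
  three-terms⇒¬∣ 2≤D1 5≤D2 10≤D3 = proper⇒¬∣ D D>0 2 (bound 2≤D1 5≤D2 10≤D3)
    where
    bound : ∀ {a b c} → 2 ≤ a → 5 ≤ b → 10 ≤ c → (1 * b + 1 * a) * c + 1 * a * b < 1 * a * b * c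
    bound 2≤a 5≤b 10≤c with m≤n⇒∃[o]m+o≡n 2≤a | m≤n⇒∃[o]m+o≡n 5≤b | m≤n⇒∃[o]m+o≡n 10≤c
    ... | u , refl | v , refl | w , refl = ≤-trans (m≤m+n _ (19 + u * 35 + v * 8 + w * 3 + u * v * 9 + u * w * 4 + v * w + u * v * w)) (≤-reflexive (eq u v w))
      where
      eq : ∀ u v w → suc ((1 * (5 + v) + 1 * (2 + u)) * (10 + w) + 1 * (2 + u) * (5 + v)) +
        (19 + u * 35 + v * 8 + w * 3 + u * v * 9 + u * w * 4 + v * w + u * v * w) ≡ 1 * (2 + u) * (5 + v) * (10 + w)
      eq = solve-∀

m≤m^n : ∀ m {n} → 0 < m → 1 ≤ n → m ≤ m ^ n
m≤m^n m m>0 1≤n = ≤-trans (≤-reflexive (sym (^-identityʳ m))) (^-monoʳ-≤ m {{>-nonZero m>0}} 1≤n)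

den-cong : ∀ {D D′} → (∀ k → D k ≡ D′ k) → ∀ n → den D n ≡ den D′ n
den-cong eq zero    = refl
den-cong eq (suc n) = cong₂ _*_ (den-cong eq n) (eq (suc n))

num-cong : ∀ {D D′} → (∀ k → D k ≡ D′ k) → ∀ n → num D n ≡ num D′ n
num-cong eq zero    = refl
num-cong eq (suc n) = cong₂ _+_ (cong₂ _*_ (num-cong eq n) (eq (suc n))) (den-cong eq n)

powers⇒¬∣ : ∀ s → (∀ k → 1 ≤ s (suc k)) → ∀ n → ¬ den (powers s) (2 + n) ∣ num (powers s) (2 + n)
powers⇒¬∣ s s≥1 n = go n
  where
  powers≥ : ∀ k → k²+1 (suc k) ≤ powers s (suc k)
  powers≥ k = m≤m^n _ (s≤s z≤n) (s≥1 k)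
  go : ∀ n → ¬ den (powers s) (2 + n) ∣ num (powers s) (2 + n)
  go 0             = two-terms⇒¬∣ (powers s) (powers>0 s) (powers≥ 0) (powers≥ 1)
  go 1             = three-terms⇒¬∣ (powers s) (powers>0 s) (powers≥ 0) (powers≥ 1) (powers≥ 2)
  go (suc (suc n)) = n≥4⇒¬∣ s s≥1 (4 + n) (m≤m+n 4 n)

theorem1p1 : (f : Poly) → DegreeAtLeast2 f →
    (s : ℕ → ℕ) → (∀ i → 1 ≤ i → 1 ≤ s i) →
    (n : ℕ) → 2 ≤ n →
    ¬ (∃ λ (z : ℤ) → H f s n ≡ z / 1)
theorem1p1 f d s s≥1 (suc (suc n)) (s≤s (s≤s _)) (z , eq) = by-shape d∣n
  where
  N = suc (suc n)
  D : ℕ → ℕ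
  D = term f s
  eval>0 : ∀ k → 0 < eval f (suc k)
  eval>0 k = ≤-trans (s≤s z≤n) (k²≤eval d k)
  D≥ : ∀ k → eval f (suc k) ≤ D (suc k)
  D≥ k = m≤m^n _ (eval>0 k) (s≥1 (suc k) (s≤s z≤n))
  D>0 : ∀ k → 0 < D (suc k)
  D>0 k = ≤-trans (eval>0 k) (D≥ k)
  d∣n : den D N ∣ num D N
  d∣n = integral⇒den∣num f s (λ k → >-nonZero (D>0 k)) N z eq
  by-shape : ¬ den D N ∣ num D N
  by-shape with eval f 1 ≟ 1
  -- The first term is then 1 whatever its exponent.
  ... | yes f1≡1 = D1≡1⇒¬∣ D D>0 (trans (cong (_^ s 1) f1≡1) (^-zeroˡ (s 1)))
                     (λ k → ≤-trans (k²≤eval d k) (D≥ k)) n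
  ... | no  f1≢1 with k[k+1]≤eval⊎k²+c d (≤∧≢⇒< (eval>0 0) (f1≢1 ∘ sym))
  ... | inj₁ k[k+1]≤     = k[k+1]≤D⇒¬∣ D D>0 (λ k → ≤-trans (k[k+1]≤ k) (D≥ k)) (suc n)
  -- For f = x² the value at 1 is 1, the case already treated.
  ... | inj₂ (0 , f≡)    = contradiction (f≡ 1) f1≢1
  ... | inj₂ (1 , f≡)    = subst₂ (λ a b → ¬ a ∣ b) (sym (den-cong same N)) (sym (num-cong same N))
                             (powers⇒¬∣ s (λ k → s≥1 (suc k) (s≤s z≤n)) n)
    where
    same : ∀ k → D k ≡ powers s k
    same k = cong (_^ s k) (trans (f≡ k) (+-comm (k * k) 1))
  ... | inj₂ (suc (suc c) , f≡) = k²+2≤D⇒¬∣ D D>0 (λ k → ≤-trans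
      (≤-trans (+-monoʳ-≤ (suc k * suc k) (s≤s (s≤s z≤n))) (≤-reflexive (sym (f≡ (suc k))))) (D≥ k)) n
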